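{- Let $V^*$ be a Lefschetz module over $E$ with center $(n+1)/2$ with a three step filtration by objects of ${\mathbb M}$: $$0\hookrightarrow F^2V^*\hookrightarrow F^1 V^*\hookrightarrow F^0V^*=V^*$$ such that their graded quotients $G^iV:=F^iV/F^{i+1}V$ are Lefschetz modules of center $(n+i)/2$. Then there is a unique splitting of filtered $E$-modules $$\alpha: G^0V^*\oplus G^1V^*\oplus G^2V^*\xrightarrow{\ \sim\ } V^*$$ such that the following hold for the restrictions $\alpha^i=\alpha |_{G^iV^*}: G^iV^*\to F^iV^*$: \begin{enumerate} \item $\alpha^1: G^1V^*\to V^*$ is $\mathsf{L}$-linear; \item $\alpha^0: G^0V^*\to V^*$ is $\mathsf{L}$-linear when taken modulo $\mathrm{Im}\, \alpha ^2$ and $\mathsf{\Lambda}$-linear when taken modulo $\mathrm{Im}\,\alpha ^1$. \end{enumerate} Moreover there is an isomorphism $\beta: G^0V^*\to G^2V^{*+1}$ of $\mathsf{L}$-modules such that $\alpha$ translates the $E[\mathsf{L}, \mathsf{\Lambda}]$-module structure on $V^*$ into the following $E[\mathsf{L}, \mathsf{\Lambda}]$-module structure on $\bigoplus_i G^iV^*$: for $x^i\in G^iV^*$, $$\mathsf{L}(x^0, x^1, x^2)=(\mathsf{L}x^0,\ \mathsf{L}x^1,\ \beta x^0+\mathsf{L}x^2),\qquad \mathsf{\Lambda}(x^0, x^1, x^2)=(\mathsf{\Lambda}x^0+\beta^{ -1}x^2,\ \mathsf{\Lambda}x^1,\ \mathsf{\Lambda}x^2),$$ i.e. in matrix form (acting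 on the column vector $(x^0,x^1,x^2)^T$) $\mathsf{L}$ is given by the matrix with rows $(\mathsf{L},0,0)$, $(0,\mathsf{L},0)$, $(\beta,0,\mathsf{L})$ and $\mathsf{\Lambda}$ by the matrix with rows $(\mathsf{\Lambda},0,\beta^{ -1})$, $(0,\mathsf{\Lambda},0)$, $(0,0,\mathsf{\Lambda})$.
   Context: $E$ is a field of characteristic $0$. ${\mathbb M}$ denotes the abelian category of graded $E$-vector spaces $V^*=\bigoplus_{i\in{\mathbb Z}}V^i$ with $V^i=0$ for $|i|\gg 0$, equipped with a linear operator $\mathsf{L}$ of degree $1$, $\mathsf{L}: V^*\to V^{*+1}$. A Lefschetz module with center $n/2$ is an object $V^*$ of ${\mathbb M}$ such that $\mathsf{L}^{n-2i}: V^i\to V^{n-i}$ is an isomorphism for all $i$ (with $i\le n/2$). On any Lefschetz module with center $n/2$ there is a unique operator $\mathsf{\Lambda}$ of degree $-1$ such that $[\mathsf{\Lambda},\mathsf{L}]|_{V^i}=n-2i$; this is the $\mathsf{\Lambda}$ used on $V^*$ (center $(n+1)/2$) and on each $G^iV^*$ (center $(n+i)/2$). -}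

module Defs where

open import Level using (0ℓ)
open import Algebra.Bundles using (CommutativeRing; Ring)
open import Algebra.Module.Bundles using (LeftModule)
open import Data.Integer as ℤ using (ℤ; +_; -[1+_]; 1ℤ)
open import Data.Nat as ℕ using (ℕ; zero; suc)
open import Data.Product using (Σ; Σ-syntax; _×_; _,_)
open import Data.Unit using (⊤; tt)
open import Relation.Nullary using (¬_)
open import Relation.Binary.PropositionalEquality using (_≡_)

record Field : Set₁ where
  field
    commutativeRing : CommutativeRing 0ℓ 0ℓ
  open CommutativeRing commutativeRing public
  field
    1≉0     : ¬ (1# ≈ 0#)
    inverse : ∀ x → ¬ (x ≈ 0#) → Σ[ y ∈ Carrier ] (x * y ≈ 1#)

module _ (E : Field) where
  open Field E

  ℕ→E : ℕ → Carrier
  ℕ→E zero    = 0#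
  ℕ→E (suc m) = 1# + ℕ→E m

  ℤ→E : ℤ → Carrier
  ℤ→E (+ m)      = ℕ→E m
  ℤ→E -[1+ m ]   = - ℕ→E (suc m)

  CharZero : Set
  CharZero = ∀ m → ¬ (ℕ→E (suc m) ≈ 0#)

shift : ℕ → ℤ → ℤ
shift zero    i = i
shift (suc m) i = shift m i ℤ.+ 1ℤ

data Piece : Set where
  g0 g1 g2 : Piece

module Graded (E : Field) (V : ℤ → LeftModule (Field.ring E) 0ℓ 0ℓ) where
  open Field E using () renaming (Carrier to Sc)

  C : ℤ → Set
  C i = LeftModule.Carrierᴹ (V i)

  EqAt : (i : ℤ) → C i → C i → Set
  EqAt i = LeftModule._≈ᴹ_ (V i)
  syntax EqAt i x y = x ≈[ i ] y

  AddAt : (i : ℤ) → C i → C i → C i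
  AddAt i = LeftModule._+ᴹ_ (V i)
  syntax AddAt i x y = x +[ i ] y

  SubAt : (i : ℤ) → C i → C i → C i
  SubAt i x y = LeftModule._+ᴹ_ (V i) x (LeftModule.-ᴹ_ (V i) y)
  syntax SubAt i x y = x -[ i ] y

  SMulAt : (i : ℤ) → Sc → C i → C i
  SMulAt i = LeftModule._*ₗ_ (V i)
  syntax SMulAt i c x = c ·[ i ] x

  0[_] : (i : ℤ) → C i
  0[ i ] = LeftModule.0ᴹ (V i)

  SubPred : Set₁
  SubPred = (i : ℤ) → C i → Set

  All : SubPred
  All _ _ = ⊤

  Zero : SubPred
  Zero i x = x ≈[ i ] 0[ i ]

  -- object of 𝕄: V^i = 0 for |i| ≫ 0
  Bounded : Set
  Bounded = Σ[ N ∈ ℕ ] (∀ i → N ℕ.< ℤ.∣ i ∣ → ∀ (x : C i) → x ≈[ i ] 0[ i ])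

  Op⁺ : Set
  Op⁺ = (i : ℤ) → C i → C (i ℤ.+ 1ℤ)

  Op⁻ : Set
  Op⁻ = (i : ℤ) → C (i ℤ.+ 1ℤ) → C i

  record Linear⁺ (L : Op⁺) : Set where
    field
      cong  : ∀ i x y → x ≈[ i ] y → L i x ≈[ i ℤ.+ 1ℤ ] L i y
      hom-+ : ∀ i x y → L i (x +[ i ] y) ≈[ i ℤ.+ 1ℤ ] (L i x +[ i ℤ.+ 1ℤ ] L i y)
      hom-· : ∀ i c x → L i (c ·[ i ] x) ≈[ i ℤ.+ 1ℤ ] (c ·[ i ℤ.+ 1ℤ ] L i x)

  record Linear⁻ (Λ : Op⁻) : Set where
    field
      cong  : ∀ i x y → x ≈[ i ℤ.+ 1ℤ ] y → Λ i x ≈[ i ] Λ i y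
      hom-+ : ∀ i x y → Λ i (x +[ i ℤ.+ 1ℤ ] y) ≈[ i ] (Λ i x +[ i ] Λ i y)
      hom-· : ∀ i c x → Λ i (c ·[ i ℤ.+ 1ℤ ] x) ≈[ i ] (c ·[ i ] Λ i x)

  Lpow : Op⁺ → (m : ℕ) → (i : ℤ) → C i → C (shift m i)
  Lpow L zero    i x = x
  Lpow L (suc m) i x = L (shift m i) (Lpow L m i x)

  record IsSubobject (L : Op⁺) (P : SubPred) : Set where
    field
      resp  : ∀ i x y → x ≈[ i ] y → P i x → P i y
      has-0 : ∀ i → P i 0[ i ]
      clo-+ : ∀ i x y → P i x → P i y → P i (x +[ i ] y)
      clo-· : ∀ i c x → P i x → P i (c ·[ i ] x)
      clo-L : ∀ i x → P i x → P (i ℤ.+ 1ℤ) (L i x)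

  -- Lefschetz property with center k/2 for the subquotient In/Next
  -- (elements of In, modulo Next): for every degree i with k - 2i = m ≥ 0,
  -- L^m : (In/Next)^i → (In/Next)^{k-i} is bijective.
  -- V^* itself is the subquotient All/Zero.
  SQLefschetz : Op⁺ → SubPred → SubPred → ℤ → Set
  SQLefschetz L In Next k =
    ∀ i m → k ℤ.- (+ 2 ℤ.* i) ≡ + m →
      (∀ x y → In i x → In i y →
         Next (shift m i) (Lpow L m i x -[ shift m i ] Lpow L m i y) →
         Next i (x -[ i ] y))
      ×
      (∀ y → In (shift m i) y →
         Σ[ x ∈ C i ] (In i x × Next (shift m i) (Lpow L m i x -[ shift m i ] y)))

  record IsLambda (L : Op⁺) (k : ℤ) (Λ : Op⁻) : Set where
    field
      linear : Linear⁻ Λ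
      comm   : ∀ i (x : C (i ℤ.+ 1ℤ)) →
        (Λ (i ℤ.+ 1ℤ) (L (i ℤ.+ 1ℤ) x) -[ i ℤ.+ 1ℤ ] L i (Λ i x))
          ≈[ i ℤ.+ 1ℤ ] (ℤ→E E (k ℤ.- (+ 2 ℤ.* (i ℤ.+ 1ℤ))) ·[ i ℤ.+ 1ℤ ] x)

  record Filtration (L : Op⁺) : Set₁ where
    field
      F1 F2  : SubPred
      F1-sub : IsSubobject L F1
      F2-sub : IsSubobject L F2
      F2⊆F1  : ∀ i x → F2 i x → F1 i x

    -- G^a = In a / Next a   (F^0 = V, F^3 = 0)
    In : Piece → SubPred
    In g0 = All
    In g1 = F1
    In g2 = F2

    Next : Piece → SubPred
    Next g0 = F1
    Next g1 = F2
    Next g2 = Zero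

    In-L : ∀ a i x → In a i x → In a (i ℤ.+ 1ℤ) (L i x)
    In-L g0 i x p = tt
    In-L g1 i x p = IsSubobject.clo-L F1-sub i x p
    In-L g2 i x p = IsSubobject.clo-L F2-sub i x p

    In-+ : ∀ a i x y → In a i x → In a i y → In a i (x +[ i ] y)
    In-+ g0 i x y p q = tt
    In-+ g1 i x y p q = IsSubobject.clo-+ F1-sub i x y p q
    In-+ g2 i x y p q = IsSubobject.clo-+ F2-sub i x y p q

    In-· : ∀ a i c x → In a i x → In a i (c ·[ i ] x)
    In-· g0 i c x p = tt
    In-· g1 i c x p = IsSubobject.clo-· F1-sub i c x p
    In-· g2 i c x p = IsSubobject.clo-· F2-sub i c x p

    pieceShift : Piece → ℤ
    pieceShift g0 = + 0
    pieceShift g1 = + 1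
    pieceShift g2 = + 2

    -- an operator Λ of degree -1 on the subquotient G^a = In a / Next a,
    -- given on representatives, with [Λ, L] = k - 2j on (G^a)^j
    record IsLambdaG (a : Piece) (k : ℤ)
        (Λ : ∀ i (x : C (i ℤ.+ 1ℤ)) → In a (i ℤ.+ 1ℤ) x → C i) : Set where
      field
        into  : ∀ i x p → In a i (Λ i x p)
        wd    : ∀ i x y p q → Next a (i ℤ.+ 1ℤ) (x -[ i ℤ.+ 1ℤ ] y) →
                  Next a i (Λ i x p -[ i ] Λ i y q)
        hom-+ : ∀ i x y p q →
                  Next a i (Λ i (x +[ i ℤ.+ 1ℤ ] y) (In-+ a (i ℤ.+ 1ℤ) x y p q)
                              -[ i ] (Λ i x p +[ i ] Λ i y q))
        hom-· : ∀ i c x p →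
                  Next a i (Λ i (c ·[ i ℤ.+ 1ℤ ] x) (In-· a (i ℤ.+ 1ℤ) c x p)
                              -[ i ] (c ·[ i ] Λ i x p))
        comm  : ∀ i x (p : In a (i ℤ.+ 1ℤ) x) →
                  Next a (i ℤ.+ 1ℤ)
                    ((Λ (i ℤ.+ 1ℤ) (L (i ℤ.+ 1ℤ) x) (In-L a (i ℤ.+ 1ℤ) x p)
                       -[ i ℤ.+ 1ℤ ] L i (Λ i x p))
                     -[ i ℤ.+ 1ℤ ]
                     (ℤ→E E (k ℤ.- (+ 2 ℤ.* (i ℤ.+ 1ℤ))) ·[ i ℤ.+ 1ℤ ] x))

module Setup (E : Field) (V : ℤ → LeftModule (Field.ring E) 0ℓ 0ℓ) where
  open Graded E V public

  record Hypotheses (n : ℤ) : Set₁ where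
    field
      L          : Op⁺
      L-linear   : Linear⁺ L
      V-bounded  : Bounded
      V-lefschetz : SQLefschetz L All Zero (n ℤ.+ 1ℤ)
      Λ          : Op⁻
      Λ-spec     : IsLambda L (n ℤ.+ 1ℤ) Λ
      filt       : Filtration L
    open Filtration filt public
    field
      G-lefschetz : ∀ a → SQLefschetz L (In a) (Next a) (n ℤ.+ pieceShift a)
      ΛG         : ∀ a i (x : C (i ℤ.+ 1ℤ)) → In a (i ℤ.+ 1ℤ) x → C i
      ΛG-spec    : ∀ a → IsLambdaG a (n ℤ.+ pieceShift a) (ΛG a)

  module _ {n : ℤ} (H : Hypotheses n) where
    open Hypotheses H

    -- α : G^0 ⊕ G^1 ⊕ G^2 → V, given by α^a on representatives
    Alpha : Set
    Alpha = ∀ a i (x : C i) → In a i x → C i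

    αsum : Alpha → ∀ i (x0 x1 : C i) → F1 i x1 → (x2 : C i) → F2 i x2 → C i
    αsum α i x0 x1 p1 x2 p2 =
      (α g0 i x0 tt +[ i ] α g1 i x1 p1) +[ i ] α g2 i x2 p2

    record IsSplitting (α : Alpha) : Set where
      field
        wd    : ∀ a i x y p q → Next a i (x -[ i ] y) → α a i x p ≈[ i ] α a i y q
        hom-+ : ∀ a i x y p q →
                  α a i (x +[ i ] y) (In-+ a i x y p q) ≈[ i ] (α a i x p +[ i ] α a i y q)
        hom-· : ∀ a i c x p →
                  α a i (c ·[ i ] x) (In-· a i c x p) ≈[ i ] (c ·[ i ] α a i x p)
        filt  : ∀ a i x p → In a i (α a i x p)
        lift  : ∀ a i x p → Next a i (α a i x p -[ i ] x)
        surj  : ∀ i (y : C i) → Σ[ x0 ∈ C i ] Σ[ x1 ∈ C i ] Σ[ p1 ∈ F1 i x1 ]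
                  Σ[ x2 ∈ C i ] Σ[ p2 ∈ F2 i x2 ] (αsum α i x0 x1 p1 x2 p2 ≈[ i ] y)
        inj   : ∀ i x0 x1 p1 x2 p2 y0 y1 q1 y2 q2 →
                  αsum α i x0 x1 p1 x2 p2 ≈[ i ] αsum α i y0 y1 q1 y2 q2 →
                  F1 i (x0 -[ i ] y0) × F2 i (x1 -[ i ] y1) × Zero i (x2 -[ i ] y2)

    Im : Alpha → Piece → SubPred
    Im α a i y = Σ[ z ∈ C i ] Σ[ p ∈ In a i z ] (y ≈[ i ] α a i z p)

    record Conditions (α : Alpha) : Set where
      field
        α1-L : ∀ i x p →
          α g1 (i ℤ.+ 1ℤ) (L i x) (In-L g1 i x p) ≈[ i ℤ.+ 1ℤ ] L i (α g1 i x p)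
        α0-L-mod-Imα2 : ∀ i x →
          Im α g2 (i ℤ.+ 1ℤ)
            (α g0 (i ℤ.+ 1ℤ) (L i x) tt -[ i ℤ.+ 1ℤ ] L i (α g0 i x tt))
        α0-Λ-mod-Imα1 : ∀ i (x : C (i ℤ.+ 1ℤ)) →
          Im α g1 i
            (α g0 i (ΛG g0 i x tt) tt -[ i ] Λ i (α g0 (i ℤ.+ 1ℤ) x tt))

    record IsLIso (β : Op⁺) : Set where
      field
        into  : ∀ i x → F2 (i ℤ.+ 1ℤ) (β i x)
        wd    : ∀ i x y → F1 i (x -[ i ] y) → β i x ≈[ i ℤ.+ 1ℤ ] β i y
        hom-+ : ∀ i x y → β i (x +[ i ] y) ≈[ i ℤ.+ 1ℤ ] (β i x +[ i ℤ.+ 1ℤ ] β i y)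
        hom-· : ∀ i c x → β i (c ·[ i ] x) ≈[ i ℤ.+ 1ℤ ] (c ·[ i ℤ.+ 1ℤ ] β i x)
        comm-L : ∀ i x →
          β (i ℤ.+ 1ℤ) (L i x) ≈[ i ℤ.+ 1ℤ ℤ.+ 1ℤ ] L (i ℤ.+ 1ℤ) (β i x)
        inv    : ∀ i (y : C (i ℤ.+ 1ℤ)) → F2 (i ℤ.+ 1ℤ) y → C i
        inv-wd : ∀ i y y' p p' → y ≈[ i ℤ.+ 1ℤ ] y' → F1 i (inv i y p -[ i ] inv i y' p')
        β∘inv  : ∀ i y p → β i (inv i y p) ≈[ i ℤ.+ 1ℤ ] y
        inv∘β  : ∀ i x → F1 i (inv i (β i x) (into i x) -[ i ] x)

    record Translates (α : Alpha) (β : Op⁺) (βiso : IsLIso β) : Set where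
      open IsLIso βiso
      field
        L-matrix : ∀ i x0 x1 p1 x2 p2 →
          L i (αsum α i x0 x1 p1 x2 p2)
            ≈[ i ℤ.+ 1ℤ ]
          αsum α (i ℤ.+ 1ℤ)
            (L i x0)
            (L i x1) (In-L g1 i x1 p1)
            (β i x0 +[ i ℤ.+ 1ℤ ] L i x2)
            (In-+ g2 (i ℤ.+ 1ℤ) (β i x0) (L i x2) (into i x0) (In-L g2 i x2 p2))
        Λ-matrix : ∀ i x0 x1 p1 x2 p2 →
          Λ i (αsum α (i ℤ.+ 1ℤ) x0 x1 p1 x2 p2)
            ≈[ i ]
          αsum α i
            (ΛG g0 i x0 tt +[ i ] inv i x2 p2)
            (ΛG g1 i x1 p1) (IsLambdaG.into (ΛG-spec g1) i x1 p1)
            (ΛG g2 i x2 p2) (IsLambdaG.into (ΛG-spec g2) i x2 p2)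

    Conclusion : Set
    Conclusion =
      Σ[ α ∈ Alpha ]
        ( (IsSplitting α × Conditions α)
        × (∀ α' → IsSplitting α' → Conditions α' →
             ∀ a i x p → α a i x p ≈[ i ] α' a i x p)
        × Σ[ β ∈ Op⁺ ] Σ[ βiso ∈ IsLIso β ] Translates α β βiso )

{-# OPTIONS --safe #-}
module Submission where

-- Every Lefschetz module carries the commutation relation [Λ, L] = k − 2i, and
-- an L-linear map between two such modules whose center grows vanishes: under
-- ad L and ad Λ it is a vector of positive weight killed by L, while the module
-- of homomorphisms is bounded.  This one principle gives everything.
--
-- Let Λ₀, Λ₁, Λ₂ be the operators on G⁰, G¹, G².  The map b = (Λ mod F¹) from F²
-- to G⁰ is L-linear of degree −1 between modules whose centers match, hence
-- Λ-linear.  On ker b, Λ takes values in F² by the principle (its class in G¹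
-- vanishes), and Λ − Λ₂ has commutator −id with L; the principle, applied to maps
-- φ for which [φ, L] commutes with Λ, gives ker b = 0.  Dually, Λ − Λ₀ shows
-- coker b = 0.  Then β = b⁻¹, and the splitting is explicit:
--   α⁰ = (Λ − Λ₂)β,   α¹ = 1 − βΛ,   α² = 1.
-- Further instances of the principle give Λα⁰ = α⁰Λ₀, Λα¹ = α¹Λ₁ and uniqueness.

open import Defs
open import Level using (Level; 0ℓ)
open import Algebra.Bundles using (AbelianGroup)
open import Algebra.Module.Bundles using (LeftModule)
open import Data.Fin using (Fin; zero; suc)
open import Data.Integer as ℤ using (ℤ; +_; -[1+_]; 1ℤ)
import Data.Integer.Properties as ℤₚ
open import Data.Integer.Tactic.RingSolver using (solve-∀)
open import Data.Nat as ℕ using (ℕ; zero; suc)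
import Data.Nat.Properties as ℕₚ
open import Data.Product using (Σ; Σ-syntax; _×_; _,_; proj₁; proj₂)
open import Data.Unit using (tt)
open import Data.Vec using (Vec; []; _∷_; lookup)
open import Relation.Nullary using (yes; no)
open import Relation.Binary.PropositionalEquality as ≡ using (_≡_)

-- Preliminaries: identities in abelian groups, and transport between degrees.

module _ {n : ℕ} where

  infixl 6 _⊕_ _⊖_
  infix  8 ⊝_

  data Expr : Set where
    var     : Fin n → Expr
    _⊕_ _⊖_ : Expr → Expr → Expr
    ⊝_      : Expr → Expr
    𝟘       : Expr

pattern v₀ = var zero
pattern v₁ = var (suc zero)
pattern v₂ = var (suc (suc zero))
pattern v₃ = var (suc (suc (suc zero)))
pattern v₄ = var (suc (suc (suc (suc zero))))
pattern v₅ = var (suc (suc (suc (suc (suc zero)))))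
pattern v₆ = var (suc (suc (suc (suc (suc (suc zero))))))
pattern v₇ = var (suc (suc (suc (suc (suc (suc (suc zero)))))))

-- Each expression is split into a positive and a negative part, so that an
-- identity of abelian groups becomes one of commutative monoids.
module AbelianGroupSolver {c ℓ : Level} (G : AbelianGroup c ℓ) where
  open AbelianGroup G
  open import Algebra.Properties.AbelianGroup G using () renaming (∙-cancelʳ to cancelʳ)
  open import Algebra.Properties.CommutativeSemigroup commutativeSemigroup
    using (interchange)
  open import Relation.Binary.Reasoning.Setoid setoid
  import Algebra.Solver.CommutativeMonoid.Normal commutativeMonoid as CM

  private variable n : ℕ

  ⟦_⟧ : Expr {n} → Vec Carrier n → Carrier
  ⟦ var i ⟧ ρ = lookup ρ i
  ⟦ e ⊕ f ⟧ ρ = ⟦ e ⟧ ρ ∙ ⟦ f ⟧ ρ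
  ⟦ e ⊖ f ⟧ ρ = ⟦ e ⟧ ρ ∙ ⟦ f ⟧ ρ ⁻¹
  ⟦ ⊝ e ⟧   ρ = ⟦ e ⟧ ρ ⁻¹
  ⟦ 𝟘 ⟧     ρ = ε

  pos neg : Expr {n} → CM.Expr n
  pos (var i) = CM.var i
  pos (e ⊕ f) = pos e CM.⊕ pos f
  pos (e ⊖ f) = pos e CM.⊕ neg f
  pos (⊝ e)   = neg e
  pos 𝟘       = CM.id
  neg (var i) = CM.id
  neg (e ⊕ f) = neg e CM.⊕ neg f
  neg (e ⊖ f) = neg e CM.⊕ pos f
  neg (⊝ e)   = pos e
  neg 𝟘       = CM.id

  neg-inverse : ∀ (e : Expr {n}) ρ {p q} → ⟦ e ⟧ ρ ∙ q ≈ p → ⟦ e ⟧ ρ ⁻¹ ∙ p ≈ q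
  neg-inverse e ρ {p} {q} h = begin
    ⟦ e ⟧ ρ ⁻¹ ∙ p              ≈⟨ ∙-congˡ h ⟨
    ⟦ e ⟧ ρ ⁻¹ ∙ (⟦ e ⟧ ρ ∙ q)  ≈⟨ assoc _ _ _ ⟨
    ⟦ e ⟧ ρ ⁻¹ ∙ ⟦ e ⟧ ρ ∙ q    ≈⟨ ∙-congʳ (inverseˡ _) ⟩
    ε ∙ q                       ≈⟨ identityˡ _ ⟩
    q                           ∎

  split : ∀ (e : Expr {n}) ρ → ⟦ e ⟧ ρ ∙ CM.⟦ neg e ⟧ ρ ≈ CM.⟦ pos e ⟧ ρ
  split (var i) ρ = identityʳ _
  split (e ⊕ f) ρ = trans (interchange _ _ _ _) (∙-cong (split e ρ) (split f ρ))
  split (e ⊖ f) ρ =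
    trans (interchange _ _ _ _) (∙-cong (split e ρ) (neg-inverse f ρ (split f ρ)))
  split (⊝ e)   ρ = neg-inverse e ρ (split e ρ)
  split 𝟘       ρ = identityʳ _

  -- The normal forms are computed from the syntax alone, so `≡.refl` proves the last hypothesis at
  -- every call.
  solve : ∀ {n} (ρ : Vec Carrier n) (e f : Expr) →
          CM.normalise (pos e CM.⊕ neg f) ≡ CM.normalise (pos f CM.⊕ neg e) →
          ⟦ e ⟧ ρ ≈ ⟦ f ⟧ ρ
  solve ρ e f eq = cancelʳ (Ne ∙ Nf) _ _ (begin
    ⟦ e ⟧ ρ ∙ (Ne ∙ Nf)               ≈⟨ assoc _ _ _ ⟨
    ⟦ e ⟧ ρ ∙ Ne ∙ Nf                 ≈⟨ ∙-congʳ (split e ρ) ⟩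
    CM.⟦ pos e CM.⊕ neg f ⟧ ρ         ≈⟨ CM.correct (pos e CM.⊕ neg f) ρ ⟨
    CM.⟦ CM.normalise (pos e CM.⊕ neg f) ⟧⇓ ρ
                                      ≡⟨ ≡.cong (λ v → CM.⟦ v ⟧⇓ ρ) eq ⟩
    CM.⟦ CM.normalise (pos f CM.⊕ neg e) ⟧⇓ ρ
                                      ≈⟨ CM.correct (pos f CM.⊕ neg e) ρ ⟩
    CM.⟦ pos f CM.⊕ neg e ⟧ ρ         ≈⟨ ∙-congʳ (split f ρ) ⟨
    ⟦ f ⟧ ρ ∙ Nf ∙ Ne                 ≈⟨ assoc _ _ _ ⟩
    ⟦ f ⟧ ρ ∙ (Nf ∙ Ne)               ≈⟨ ∙-congˡ (comm _ _) ⟩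
    ⟦ f ⟧ ρ ∙ (Ne ∙ Nf)               ∎)
    where
    Ne = CM.⟦ neg e ⟧ ρ
    Nf = CM.⟦ neg f ⟧ ρ

-- Λ i is only defined on degrees of the form i + 1; every degree has this form,
-- but only up to propositional equality.
abstract
  at-suc : ∀ {ℓ} (P : ℤ → Set ℓ) → (∀ j → P (j ℤ.+ 1ℤ)) → ∀ i → P i
  at-suc P f i = ≡.subst P (pred-suc i) (f (i ℤ.- 1ℤ))
    where
    pred-suc : ∀ i → i ℤ.- 1ℤ ℤ.+ 1ℤ ≡ i
    pred-suc = solve-∀

  at-suc-β : ∀ {ℓ} (P : ℤ → Set ℓ) (f : ∀ j → P (j ℤ.+ 1ℤ)) j → at-suc P f (j ℤ.+ 1ℤ) ≡ f j
  at-suc-β P f j = subst-fibre (j ℤ.+ 1ℤ ℤ.- 1ℤ) _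
    where
    open import Algebra.Properties.AbelianGroup ℤₚ.+-0-abelianGroup
      using () renaming (∙-cancelʳ to cancelʳ)

    -- Generalised to a variable `k`, because `e` cannot be matched directly: cancelling 1
    -- identifies `k` with `j`, and then `e` is a loop, trivial by axiom K.
    subst-fibre : ∀ k (e : k ℤ.+ 1ℤ ≡ j ℤ.+ 1ℤ) → ≡.subst P e (f k) ≡ f j
    subst-fibre k e with cancelʳ 1ℤ k j e
    subst-fibre k ≡.refl | ≡.refl = ≡.refl

-- Integers in the field and arithmetic in modules.

module Sl2Theory (E : Field) (char0 : CharZero E) where
  open Field E

  ℕ→E-+ : ∀ a b → ℕ→E E (a ℕ.+ b) ≈ ℕ→E E a + ℕ→E E b
  ℕ→E-+ zero    b = sym (+-identityˡ _)
  ℕ→E-+ (suc a) b = trans (+-congˡ (ℕ→E-+ a b)) (sym (+-assoc _ _ _))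

  ℤ→E-suc : ∀ a → ℤ→E E (a ℤ.+ 1ℤ) ≈ ℤ→E E a + 1#
  ℤ→E-suc (+ m)          = trans (reflexive (≡.cong (ℕ→E E) (ℕₚ.+-comm m 1))) (+-comm _ _)
  ℤ→E-suc -[1+ zero ]    =
    sym (trans (+-congʳ (-‿cong (+-identityʳ _))) (-‿inverseˡ _))
  ℤ→E-suc -[1+ suc m ]   =
    sym (cancel (ℕ→E E (suc m)))
    where
    open AbelianGroupSolver +-abelianGroup
    cancel : ∀ x → - (1# + x) + 1# ≈ - x
    cancel x = solve (1# ∷ x ∷ []) (⊝ (v₀ ⊕ v₁) ⊕ v₀) (⊝ v₁) ≡.refl

  ℤ→E-+ : ∀ a m → ℤ→E E (a ℤ.+ + m) ≈ ℤ→E E a + ℕ→E E m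
  ℤ→E-+ a zero    =
    trans (reflexive (≡.cong (ℤ→E E) (ℤₚ.+-identityʳ a))) (sym (+-identityʳ _))
  ℤ→E-+ a (suc m) =
    trans (reflexive (≡.cong (ℤ→E E) (≡.sym (ℤₚ.+-assoc a 1ℤ (+ m)))))
    (trans (ℤ→E-+ (a ℤ.+ 1ℤ) m)
    (trans (+-congʳ (ℤ→E-suc a)) (+-assoc _ _ _)))

  module ModuleLemmas (M : LeftModule ring 0ℓ 0ℓ) where
    open LeftModule M public
    open AbelianGroupSolver +ᴹ-abelianGroup public using (solve)
    open import Algebra.Properties.AbelianGroup +ᴹ-abelianGroup public
      using () renaming (x∙y⁻¹≈ε⇒x≈y to difference≈0⇒≈; x≈y⇒x∙y⁻¹≈ε to ≈⇒difference≈0)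
    open import Relation.Binary.Reasoning.Setoid ≈ᴹ-setoid public

    infixl 6 _-ᴹ_
    _-ᴹ_ : Carrierᴹ → Carrierᴹ → Carrierᴹ
    x -ᴹ y = x +ᴹ -ᴹ y

    -ᴹ-cong : ∀ {x x′ y y′} → x ≈ᴹ x′ → y ≈ᴹ y′ → x -ᴹ y ≈ᴹ x′ -ᴹ y′
    -ᴹ-cong p q = +ᴹ-cong p (-ᴹ‿cong q)

    -- Linear maps and subobjects are specified by sums and scalar multiples only; this extends them
    -- to negatives.
    neg-as-scale : ∀ x → -ᴹ x ≈ᴹ (- 1#) *ₗ x
    neg-as-scale x = begin
      -ᴹ x                                      ≈⟨ solve (x ∷ []) (⊝ v₀) (𝟘 ⊖ v₀) ≡.refl ⟩
      0ᴹ -ᴹ x                                   ≈⟨ -ᴹ-cong (*ₗ-zeroˡ x) (*ₗ-identityˡ x) ⟨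
      0# *ₗ x -ᴹ 1# *ₗ x                        ≈⟨ -ᴹ-cong (*ₗ-congʳ (-‿inverseˡ 1#)) ≈ᴹ-refl ⟨
      (- 1# + 1#) *ₗ x -ᴹ 1# *ₗ x               ≈⟨ -ᴹ-cong (*ₗ-distribʳ x _ _) ≈ᴹ-refl ⟩
      (- 1#) *ₗ x +ᴹ 1# *ₗ x -ᴹ 1# *ₗ x
        ≈⟨ solve ((- 1#) *ₗ x ∷ 1# *ₗ x ∷ []) (v₀ ⊕ v₁ ⊖ v₁) v₀ ≡.refl ⟩
      (- 1#) *ₗ x                               ∎

    *ₗ-hom-minus : ∀ c x y → c *ₗ (x -ᴹ y) ≈ᴹ c *ₗ x -ᴹ c *ₗ y
    *ₗ-hom-minus c x y = begin
      c *ₗ (x -ᴹ y)                        ≈⟨ solve (_ ∷ _ ∷ []) v₀ (v₀ ⊕ v₁ ⊖ v₁) ≡.refl ⟩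
      c *ₗ (x -ᴹ y) +ᴹ c *ₗ y -ᴹ c *ₗ y    ≈⟨ -ᴹ-cong (*ₗ-distribˡ c _ _) ≈ᴹ-refl ⟨
      c *ₗ (x -ᴹ y +ᴹ y) -ᴹ c *ₗ y         ≈⟨ -ᴹ-cong (*ₗ-congˡ (solve (x ∷ y ∷ []) (v₀ ⊖ v₁ ⊕ v₁) v₀ ≡.refl)) ≈ᴹ-refl ⟩
      c *ₗ x -ᴹ c *ₗ y                     ∎

    ℤ→E-scale-+ : ∀ {a b} m → a ≡ b ℤ.+ + m → ∀ x →
                  ℤ→E E a *ₗ x ≈ᴹ ℤ→E E b *ₗ x +ᴹ ℕ→E E m *ₗ x
    ℤ→E-scale-+ {b = b} m ≡.refl x = ≈ᴹ-trans (*ₗ-congʳ (ℤ→E-+ b m)) (*ₗ-distribʳ x _ _)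

    ℤ→E-scale-suc : ∀ {a b} → a ≡ b ℤ.+ 1ℤ → ∀ x → ℤ→E E a *ₗ x ≈ᴹ ℤ→E E b *ₗ x +ᴹ x
    ℤ→E-scale-suc {b = b} ≡.refl x =
      ≈ᴹ-trans (*ₗ-congʳ (ℤ→E-suc b)) (≈ᴹ-trans (*ₗ-distribʳ x _ _) (+ᴹ-congˡ (*ₗ-identityˡ x)))

    -- Positive integers are invertible in `E`. Characteristic 0 enters the proof here and nowhere
    -- else.
    nat-scale-injective : ∀ m {x} → ℕ→E E (suc m) *ₗ x ≈ᴹ 0ᴹ → x ≈ᴹ 0ᴹ
    nat-scale-injective m {x} cx≈0 = let (c⁻¹ , cc⁻¹≈1) = inverse _ (char0 m) in begin
      x                              ≈⟨ *ₗ-identityˡ x ⟨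
      1# *ₗ x                        ≈⟨ *ₗ-congʳ cc⁻¹≈1 ⟨
      (ℕ→E E (suc m) * c⁻¹) *ₗ x     ≈⟨ *ₗ-congʳ (*-comm _ _) ⟩
      (c⁻¹ * ℕ→E E (suc m)) *ₗ x     ≈⟨ *ₗ-assoc _ _ _ ⟩
      c⁻¹ *ₗ (ℕ→E E (suc m) *ₗ x)    ≈⟨ *ₗ-congˡ cx≈0 ⟩
      c⁻¹ *ₗ 0ᴹ                      ≈⟨ *ₗ-zeroʳ _ ⟩
      0ᴹ                             ∎

  -- Linear maps, and graded modules with a pair of operators L, Λ.

  Family : Set₁
  Family = ℤ → LeftModule ring 0ℓ 0ℓ

  record LinearMap (A B : LeftModule ring 0ℓ 0ℓ) : Set where
    private
      module A = LeftModule A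
      module B = ModuleLemmas B
    field
      apply : A.Carrierᴹ → B.Carrierᴹ
      cong  : ∀ x y → x A.≈ᴹ y → apply x B.≈ᴹ apply y
      hom-+ : ∀ x y → apply (x A.+ᴹ y) B.≈ᴹ apply x B.+ᴹ apply y
      hom-· : ∀ c x → apply (c A.*ₗ x) B.≈ᴹ c B.*ₗ apply x

    hom-neg : ∀ x → apply (A.-ᴹ x) B.≈ᴹ B.-ᴹ apply x
    hom-neg x = B.≈ᴹ-trans (cong _ _ (ModuleLemmas.neg-as-scale A x))
      (B.≈ᴹ-trans (hom-· _ x) (B.≈ᴹ-sym (B.neg-as-scale _)))

    hom-minus : ∀ x y → apply (x A.+ᴹ A.-ᴹ y) B.≈ᴹ apply x B.-ᴹ apply y
    hom-minus x y = B.≈ᴹ-trans (hom-+ x _) (B.+ᴹ-congˡ (hom-neg y))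

    -- Failure to commute with an operator is additive. With `apply` equal to L or Λ, this turns a
    -- condition on each of two splittings into one on their difference.
    difference-defect : ∀ u u′ x x′ →
      (u B.-ᴹ u′) B.-ᴹ apply (x A.+ᴹ A.-ᴹ x′) B.≈ᴹ (u B.-ᴹ apply x) B.-ᴹ (u′ B.-ᴹ apply x′)
    difference-defect u u′ x x′ = B.≈ᴹ-trans (B.-ᴹ-cong B.≈ᴹ-refl (hom-minus x x′))
      (B.solve (_ ∷ _ ∷ _ ∷ _ ∷ []) (v₀ ⊖ v₁ ⊖ (v₂ ⊖ v₃)) (v₀ ⊖ v₂ ⊖ (v₁ ⊖ v₃)) ≡.refl)

    hom-0 : apply A.0ᴹ B.≈ᴹ B.0ᴹ
    hom-0 = B.≈ᴹ-trans (cong _ _ (A.≈ᴹ-sym (A.*ₗ-zeroˡ _)))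
      (B.≈ᴹ-trans (hom-· _ A.0ᴹ) (B.*ₗ-zeroˡ _))

  -- `k` is twice the center. Only the operators and their commutator are recorded, so kernels and
  -- cokernels stable under both are again instances.
  record Sl2Module (k : ℤ) : Set₁ where
    field
      family   : Family
    open Graded E family public
    field
      L        : Op⁺
      Λ        : Op⁻
      L-linear : Linear⁺ L
      Λ-spec   : IsLambda L k Λ

    module At (i : ℤ) = ModuleLemmas (family i)

    L-map : ∀ i → LinearMap (family i) (family (i ℤ.+ 1ℤ))
    L-map i = record { apply = L i ; cong = cong i ; hom-+ = hom-+ i ; hom-· = hom-· i }
      where open Linear⁺ L-linear

    Λ-map : ∀ i → LinearMap (family (i ℤ.+ 1ℤ)) (family i)
    Λ-map i = record { apply = Λ i ; cong = cong i ; hom-+ = hom-+ i ; hom-· = hom-· i }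
      where open Linear⁻ (IsLambda.linear Λ-spec)

  -- Degree `i` of the shift is degree `i + 1` of `M`, where the weight is k - 2(i + 1) = (k - 2) -
  -- 2i.
  shifted : ∀ {k} → Sl2Module k → Sl2Module (k ℤ.- + 2)
  shifted {k} M = record
    { family   = λ i → M.family (i ℤ.+ 1ℤ)
    ; L        = λ i → M.L (i ℤ.+ 1ℤ)
    ; Λ        = λ i → M.Λ (i ℤ.+ 1ℤ)
    ; L-linear = record
      { cong  = λ i → M.Linear⁺.cong M.L-linear (i ℤ.+ 1ℤ)
      ; hom-+ = λ i → M.Linear⁺.hom-+ M.L-linear (i ℤ.+ 1ℤ)
      ; hom-· = λ i → M.Linear⁺.hom-· M.L-linear (i ℤ.+ 1ℤ)
      }
    ; Λ-spec = record
      { linear = record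
        { cong  = λ i → M.Linear⁻.cong Λ-linear (i ℤ.+ 1ℤ)
        ; hom-+ = λ i → M.Linear⁻.hom-+ Λ-linear (i ℤ.+ 1ℤ)
        ; hom-· = λ i → M.Linear⁻.hom-· Λ-linear (i ℤ.+ 1ℤ)
        }
      ; comm = λ i x → let open M.At (i ℤ.+ 1ℤ ℤ.+ 1ℤ) in
          ≈ᴹ-trans (M.IsLambda.comm M.Λ-spec (i ℤ.+ 1ℤ) x)
            (*ₗ-congʳ (reflexive (≡.cong (ℤ→E E) (weight-shift k i))))
      }
    }
    where
    module M = Sl2Module M
    Λ-linear = M.IsLambda.linear M.Λ-spec
    weight-shift : ∀ k i → k ℤ.- (+ 2 ℤ.* (i ℤ.+ 1ℤ ℤ.+ 1ℤ)) ≡ k ℤ.- + 2 ℤ.- (+ 2 ℤ.* (i ℤ.+ 1ℤ))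
    weight-shift = solve-∀

  -- Boundedness and the vanishing principle for homomorphisms.

  VanishesAbove : ℕ → Family → ℕ → Set
  VanishesAbove B V r = ∀ i → + r ℤ.≤ i ℤ.+ + B → ∀ x → Graded.Zero E V i x

  -- If the source vanishes from degree r - B on and the target vanishes below -B, a homomorphism
  -- can be nonzero in `r` degrees only. A shift of the source lowers `r` by one, which makes `r`
  -- the induction variable.
  VanishesBelow : ℕ → Family → Set
  VanishesBelow B V = ∀ i → i ℤ.+ + B ℤ.< + 0 → ∀ x → Graded.Zero E V i x

  -- The degree-0 morphisms M → N[−j] form an sl₂-module under ad L and ad Λ; a
  -- morphism M → N[−1] is viewed as a degree-0 morphism out of the shift of M.
  module Hom {kN : ℤ} (N : Sl2Module kN) where
    private
      module N = Sl2Module N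
      module NΛ i = LinearMap (N.Λ-map i)
      module NL i = LinearMap (N.L-map i)

    Hom : Family → Set
    Hom F = ∀ i → LinearMap (F i) (N.family i)

    module _ {kM : ℤ} (M : Sl2Module kM) (φ : Hom (Sl2Module.family M)) where
      private
        module M = Sl2Module M
        module MΛ i = LinearMap (M.Λ-map i)
        module φ i = LinearMap (φ i)

      defect : ∀ i → M.C i → N.C (i ℤ.+ 1ℤ)
      defect i x = φ.apply (i ℤ.+ 1ℤ) (M.L i x) N.-[ i ℤ.+ 1ℤ ] N.L i (φ.apply i x)

      adΛ : Hom (λ i → M.family (i ℤ.+ 1ℤ))
      adΛ i = record
        { apply = λ x → N.Λ i (φ.apply (i ℤ.+ 1ℤ) x) -ᴹ φ.apply i (M.Λ i x)
        ; cong  = λ x y x≈y →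
            -ᴹ-cong (NΛ.cong i _ _ (φ.cong (i ℤ.+ 1ℤ) _ _ x≈y)) (φ.cong i _ _ (MΛ.cong i _ _ x≈y))
        ; hom-+ = λ x y → ≈ᴹ-trans
            (-ᴹ-cong (≈ᴹ-trans (NΛ.cong i _ _ (φ.hom-+ (i ℤ.+ 1ℤ) x y)) (NΛ.hom-+ i _ _))
                     (≈ᴹ-trans (φ.cong i _ _ (MΛ.hom-+ i x y)) (φ.hom-+ i _ _)))
            (solve (_ ∷ _ ∷ _ ∷ _ ∷ []) (v₀ ⊕ v₁ ⊖ (v₂ ⊕ v₃)) (v₀ ⊖ v₂ ⊕ (v₁ ⊖ v₃)) ≡.refl)
        ; hom-· = λ c x → ≈ᴹ-trans
            (-ᴹ-cong (≈ᴹ-trans (NΛ.cong i _ _ (φ.hom-· (i ℤ.+ 1ℤ) c x)) (NΛ.hom-· i _ _))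
                     (≈ᴹ-trans (φ.cong i _ _ (MΛ.hom-· i c x)) (φ.hom-· i _ _)))
            (≈ᴹ-sym (*ₗ-hom-minus c _ _))
        }
        where open N.At i

    -- The Jacobi identity for ad L and ad Λ, with [Λ, L] acting by the weight.
    defect-adΛ : ∀ {kM w} (M : Sl2Module kM) (φ : Hom (Sl2Module.family M)) →
      kN ≡ kM ℤ.+ + w → ∀ i (x : Sl2Module.C M (i ℤ.+ 1ℤ)) →
      defect (shifted M) (adΛ M φ) i x N.≈[ i ℤ.+ 1ℤ ]
        ((N.Λ (i ℤ.+ 1ℤ) (defect M φ (i ℤ.+ 1ℤ) x) N.-[ i ℤ.+ 1ℤ ] defect M φ i (Sl2Module.Λ M i x))
          N.+[ i ℤ.+ 1ℤ ] (ℕ→E E w N.·[ i ℤ.+ 1ℤ ] LinearMap.apply (φ (i ℤ.+ 1ℤ)) x))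
    defect-adΛ {kM} {w} M φ ≡.refl i x = begin
      (a -ᴹ b) -ᴹ N.L i (N.Λ i φx N.-[ i ] φ.apply i (M.Λ i x))
        ≈⟨ -ᴹ-cong ≈ᴹ-refl (NL.hom-minus i _ _) ⟩
      (a -ᴹ b) -ᴹ (c -ᴹ d)
        ≈⟨ -ᴹ-cong (-ᴹ-cong ≈ᴹ-refl b≈) ≈ᴹ-refl ⟩
      (a -ᴹ (h +ᴹ f)) -ᴹ (c -ᴹ d)
        ≈⟨ solve (a ∷ h ∷ f ∷ c ∷ d ∷ g ∷ []) (v₀ ⊖ (v₁ ⊕ v₂) ⊖ (v₃ ⊖ v₄))
                 (v₀ ⊖ ((v₁ ⊕ v₅) ⊕ v₃) ⊖ (v₂ ⊖ v₄) ⊕ v₅) ≡.refl ⟩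
      ((a -ᴹ ((h +ᴹ g) +ᴹ c)) -ᴹ (f -ᴹ d)) +ᴹ g
        ≈⟨ +ᴹ-congʳ (-ᴹ-cong (-ᴹ-cong ≈ᴹ-refl e≈) ≈ᴹ-refl) ⟨
      ((a -ᴹ e) -ᴹ (f -ᴹ d)) +ᴹ g
        ≈⟨ +ᴹ-congʳ (-ᴹ-cong (NΛ.hom-minus (i ℤ.+ 1ℤ) _ _) ≈ᴹ-refl) ⟨
      (N.Λ (i ℤ.+ 1ℤ) (defect M φ (i ℤ.+ 1ℤ) x) -ᴹ (f -ᴹ d)) +ᴹ g
        ∎
      where
      module M = Sl2Module M
      module φ i = LinearMap (φ i)
      open N.At (i ℤ.+ 1ℤ)
      φx = φ.apply (i ℤ.+ 1ℤ) x
      a = N.Λ (i ℤ.+ 1ℤ) (φ.apply (i ℤ.+ 1ℤ ℤ.+ 1ℤ) (M.L (i ℤ.+ 1ℤ) x))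
      b = φ.apply (i ℤ.+ 1ℤ) (M.Λ (i ℤ.+ 1ℤ) (M.L (i ℤ.+ 1ℤ) x))
      c = N.L i (N.Λ i φx)
      d = N.L i (φ.apply i (M.Λ i x))
      e = N.Λ (i ℤ.+ 1ℤ) (N.L (i ℤ.+ 1ℤ) φx)
      f = φ.apply (i ℤ.+ 1ℤ) (M.L i (M.Λ i x))
      g = ℕ→E E w *ₗ φx
      h = ℤ→E E (kM ℤ.- (+ 2 ℤ.* (i ℤ.+ 1ℤ))) *ₗ φx
      weights : ∀ k j m → k ℤ.+ m ℤ.- (+ 2 ℤ.* j) ≡ k ℤ.- (+ 2 ℤ.* j) ℤ.+ m
      weights = solve-∀
      b≈ : b ≈ᴹ h +ᴹ f
      b≈ = begin
        b            ≈⟨ solve (b ∷ f ∷ []) v₀ (v₀ ⊖ v₁ ⊕ v₁) ≡.refl ⟩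
        b -ᴹ f +ᴹ f  ≈⟨ +ᴹ-congʳ (≈ᴹ-trans (≈ᴹ-sym (φ.hom-minus _ _ _))
                          (≈ᴹ-trans (φ.cong _ _ _ (M.IsLambda.comm M.Λ-spec i x)) (φ.hom-· _ _ _))) ⟩
        h +ᴹ f       ∎
      e≈ : e ≈ᴹ (h +ᴹ g) +ᴹ c
      e≈ = begin
        e            ≈⟨ solve (e ∷ c ∷ []) v₀ (v₀ ⊖ v₁ ⊕ v₁) ≡.refl ⟩
        e -ᴹ c +ᴹ c  ≈⟨ +ᴹ-congʳ (≈ᴹ-trans (N.IsLambda.comm N.Λ-spec i φx)
                          (ℤ→E-scale-+ {b = kM ℤ.- (+ 2 ℤ.* (i ℤ.+ 1ℤ))} w
                            (weights kM (i ℤ.+ 1ℤ) (+ w)) φx)) ⟩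
        (h +ᴹ g) +ᴹ c  ∎

    -- [Λ, [φ, L]] = (d − w) φ, where w is the difference of the centers times 2.
    Eigen : ∀ {kM} (M : Sl2Module kM) → Hom (Sl2Module.family M) → ℕ → ℕ → Set
    Eigen M φ w d = ∀ i (x : M.C (i ℤ.+ 1ℤ)) →
      ((N.Λ (i ℤ.+ 1ℤ) (defect M φ (i ℤ.+ 1ℤ) x) N.-[ i ℤ.+ 1ℤ ] defect M φ i (M.Λ i x))
        N.+[ i ℤ.+ 1ℤ ] (ℕ→E E w N.·[ i ℤ.+ 1ℤ ] LinearMap.apply (φ (i ℤ.+ 1ℤ)) x))
      N.≈[ i ℤ.+ 1ℤ ] (ℕ→E E d N.·[ i ℤ.+ 1ℤ ] LinearMap.apply (φ (i ℤ.+ 1ℤ)) x)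
      where module M = Sl2Module M

    IsZero : ∀ {F} → Hom F → Set
    IsZero φ = ∀ i x → LinearMap.apply (φ i) x N.≈[ i ] N.0[ i ]

    adΛ-zero : ∀ {kM} (M : Sl2Module kM) φ → IsZero φ → IsZero (adΛ M φ)
    adΛ-zero M φ φ≈0 i x = begin
      N.Λ i (φ.apply (i ℤ.+ 1ℤ) x) -ᴹ φ.apply i (Sl2Module.Λ M i x)
        ≈⟨ -ᴹ-cong (≈ᴹ-trans (NΛ.cong i _ _ (φ≈0 _ x)) (NΛ.hom-0 i)) (φ≈0 i _) ⟩
      0ᴹ -ᴹ 0ᴹ  ≈⟨ solve [] (𝟘 ⊖ 𝟘) 𝟘 ≡.refl ⟩
      0ᴹ ∎
      where
      open N.At i
      module φ i = LinearMap (φ i)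

    defect-zero : ∀ {kM} (M : Sl2Module kM) φ → IsZero φ →
      ∀ i x → defect M φ i x N.≈[ i ℤ.+ 1ℤ ] N.0[ i ℤ.+ 1ℤ ]
    defect-zero M φ φ≈0 i x = ≈ᴹ-trans
      (-ᴹ-cong (φ≈0 _ _) (≈ᴹ-trans (NL.cong i _ _ (φ≈0 i x)) (NL.hom-0 i)))
      (solve [] (𝟘 ⊖ 𝟘) 𝟘 ≡.refl)
      where open N.At (i ℤ.+ 1ℤ)

    -- By `defect-adΛ` the eigenvalue equation reads [[Λ, φ], L] = (d + 1)φ, so φ can be recovered
    -- from [Λ, φ] after dividing by a positive integer.
    eigen-zero : ∀ {kM w d} (M : Sl2Module kM) φ → kN ≡ kM ℤ.+ + w →
      Eigen M φ w (suc d) → IsZero (adΛ M φ) → IsZero φ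
    eigen-zero {d = d} M φ weight eigen ad≈0 = at-suc _ λ i x → let open N.At (i ℤ.+ 1ℤ) in
      nat-scale-injective d (≈ᴹ-trans
        (≈ᴹ-sym (≈ᴹ-trans (defect-adΛ M φ weight i x) (eigen i x)))
        (defect-zero (shifted M) (adΛ M φ) ad≈0 i x))

    -- Since [[Λ, φ], L] = dφ, a further bracket with Λ gives d[Λ, φ]. The shift of the source
    -- raises w to w + 2, and this is added to the eigenvalue, which therefore grows along the
    -- string.
    eigen-adΛ : ∀ {kM w d} (M : Sl2Module kM) φ → kN ≡ kM ℤ.+ + w →
      Eigen M φ w d → Eigen (shifted M) (adΛ M φ) (2 ℕ.+ w) (2 ℕ.+ w ℕ.+ d)
    eigen-adΛ {w = w} {d} M φ weight eigen i x = begin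
      N.Λ (i ℤ.+ 1ℤ) (defect (shifted M) (adΛ M φ) (i ℤ.+ 1ℤ) x)
        -ᴹ defect (shifted M) (adΛ M φ) i (M.Λ (i ℤ.+ 1ℤ) x) +ᴹ w′ *ₗ adφx
        ≈⟨ +ᴹ-congʳ (-ᴹ-cong (≈ᴹ-trans (NΛ.cong _ _ _ (commutator (i ℤ.+ 1ℤ) x)) (NΛ.hom-· _ _ _))
                             (commutator i _)) ⟩
      ℕ→E E d *ₗ N.Λ (i ℤ.+ 1ℤ) (φ.apply _ x)
        -ᴹ ℕ→E E d *ₗ φ.apply _ (M.Λ (i ℤ.+ 1ℤ) x) +ᴹ w′ *ₗ adφx
        ≈⟨ +ᴹ-congʳ (*ₗ-hom-minus (ℕ→E E d) _ _) ⟨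
      ℕ→E E d *ₗ adφx +ᴹ w′ *ₗ adφx
        ≈⟨ +ᴹ-comm _ _ ⟩
      w′ *ₗ adφx +ᴹ ℕ→E E d *ₗ adφx
        ≈⟨ *ₗ-distribʳ _ _ _ ⟨
      (w′ + ℕ→E E d) *ₗ adφx
        ≈⟨ *ₗ-congʳ (ℕ→E-+ (2 ℕ.+ w) d) ⟨
      ℕ→E E (2 ℕ.+ w ℕ.+ d) *ₗ adφx ∎
      where
      open N.At (i ℤ.+ 1ℤ)
      module M = Sl2Module M
      module φ i = LinearMap (φ i)
      w′ = ℕ→E E (2 ℕ.+ w)
      adφx = LinearMap.apply (adΛ M φ (i ℤ.+ 1ℤ)) x
      commutator : ∀ i x → defect (shifted M) (adΛ M φ) i x N.≈[ i ℤ.+ 1ℤ ]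
                   (ℕ→E E d N.·[ i ℤ.+ 1ℤ ] φ.apply (i ℤ.+ 1ℤ) x)
      commutator i x = N.At.≈ᴹ-trans (i ℤ.+ 1ℤ) (defect-adΛ M φ weight i x) (eigen i x)

    -- The eigenvalue 2 + w + d of [Λ, φ] is positive even when d = 0, so `eigen-zero` reduces the
    -- claim to [Λ, [Λ, φ]]. Each bracket shifts the source and lowers `r`; at `r` = 0 no degree is
    -- left. The case d = 0 is the source of all Λ-linearity statements below.
    adΛ-vanishes : ∀ {B} → VanishesBelow B N.family → ∀ r {kM w d} (M : Sl2Module kM) φ → kN ≡ kM ℤ.+ + w →
      Eigen M φ w d → VanishesAbove B (Sl2Module.family M) r → IsZero (adΛ M φ)
    adΛ-vanishes {B} below zero M φ weight eigen above = adΛ-zero M φ φ≈0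
      where
      φ≈0 : IsZero φ
      φ≈0 i x with + 0 ℤ.≤? i ℤ.+ + B
      ... | no  i+B≱0 = below i (ℤₚ.≰⇒> i+B≱0) _
      ... | yes 0≤i+B = N.At.≈ᴹ-trans i (LinearMap.cong (φ i) _ _ (above i 0≤i+B x))
                           (LinearMap.hom-0 (φ i))
    adΛ-vanishes {B} below (suc r) {kM} {w} {d} M φ ≡.refl eigen above =
      eigen-zero {d = suc (w ℕ.+ d)} (shifted M) (adΛ M φ) weight′ eigen′
        (adΛ-vanishes below r {d = 2 ℕ.+ w ℕ.+ d} (shifted M) (adΛ M φ) weight′ eigen′ above′)
      where
      weight-eq : ∀ k w → k ℤ.+ w ≡ k ℤ.- + 2 ℤ.+ (+ 2 ℤ.+ w)
      weight-eq = solve-∀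
      weight′ = weight-eq kM (+ w)
      eigen′ = eigen-adΛ {d = d} M φ ≡.refl eigen
      regroup : ∀ i b → 1ℤ ℤ.+ (i ℤ.+ b) ≡ i ℤ.+ 1ℤ ℤ.+ b
      regroup = solve-∀
      above′ : VanishesAbove B (λ i → Sl2Module.family M (i ℤ.+ 1ℤ)) r
      above′ i r≤ = above (i ℤ.+ 1ℤ)
        (≡.subst (+ suc r ℤ.≤_) (regroup i (+ B)) (ℤₚ.+-monoʳ-≤ 1ℤ r≤))

    -- A positive eigenvalue of φ itself permits one more descent, from [Λ, φ] = 0 to φ = 0.
    vanishes : ∀ {B} → VanishesBelow B N.family → ∀ r {kM w d} (M : Sl2Module kM) φ → kN ≡ kM ℤ.+ + w →
      Eigen M φ w (suc d) → VanishesAbove B (Sl2Module.family M) r → IsZero φ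
    vanishes below r {d = d} M φ weight eigen above =
      eigen-zero {d = d} M φ weight eigen (adΛ-vanishes below r {d = suc d} M φ weight eigen above)

    DefectCommutes : ∀ {kM} (M : Sl2Module kM) → Hom (Sl2Module.family M) → Set
    DefectCommutes M φ = ∀ i x →
      N.Λ (i ℤ.+ 1ℤ) (defect M φ (i ℤ.+ 1ℤ) x) N.≈[ i ℤ.+ 1ℤ ] defect M φ i (Sl2Module.Λ M i x)

    -- When [Λ, [φ, L]] = 0, only wφ remains, so the eigenvalue is the growth of twice the center.
    -- For w > 0 the map then vanishes; for w = 0 it is Λ-linear.
    defect-commutes⇒eigen : ∀ {kM} (M : Sl2Module kM) φ w → DefectCommutes M φ → Eigen M φ w w
    defect-commutes⇒eigen M φ w commutes i x = ≈ᴹ-trans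
      (+ᴹ-congʳ (-ᴹ-cong (commutes i x) ≈ᴹ-refl))
      (solve (_ ∷ _ ∷ []) (v₀ ⊖ v₀ ⊕ v₁) v₁ ≡.refl)
      where open N.At (i ℤ.+ 1ℤ)

    IsLLinear : ∀ {kM} (M : Sl2Module kM) → Hom (Sl2Module.family M) → Set
    IsLLinear M φ = ∀ i x → defect M φ i x N.≈[ i ℤ.+ 1ℤ ] N.0[ i ℤ.+ 1ℤ ]

    linear⇒defect-commutes : ∀ {kM} (M : Sl2Module kM) φ → IsLLinear M φ → DefectCommutes M φ
    linear⇒defect-commutes M φ linear i x = ≈ᴹ-trans
      (≈ᴹ-trans (NΛ.cong _ _ _ (linear _ x)) (NΛ.hom-0 _))
      (≈ᴹ-sym (linear i _))
      where open N.At (i ℤ.+ 1ℤ)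

  -- Subobjects, subquotients and their bounds.

  module Subobject {V : Family} {L : Graded.Op⁺ E V} {P : Graded.SubPred E V}
                   (sub : Graded.IsSubobject E V L P) where
    open Graded E V
    open IsSubobject sub public
    private module At i = ModuleLemmas (V i)

    mem : ∀ i {x y} → P i y → x ≈[ i ] y → P i x
    mem i py x≈y = resp i _ _ (At.≈ᴹ-sym i x≈y) py

    mem-0 : ∀ i {x} → x ≈[ i ] 0[ i ] → P i x
    mem-0 i = mem i (has-0 i)

    clo-neg : ∀ i {x} → P i x → P i (LeftModule.-ᴹ_ (V i) x)
    clo-neg i px = mem i (clo-· i _ _ px) (At.neg-as-scale i _)

    clo-minus : ∀ i {x y} → P i x → P i y → P i (x -[ i ] y)
    clo-minus i px py = clo-+ i _ _ px (clo-neg i py)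

    ≈⇒mem : ∀ i {x y} → x ≈[ i ] y → P i (x -[ i ] y)
    ≈⇒mem i x≈y = mem-0 i (At.≈⇒difference≈0 i x≈y)

    swap : ∀ i {x y} → P i (x -[ i ] y) → P i (y -[ i ] x)
    swap i p = mem i (clo-neg i p)
      (At.solve i (_ ∷ _ ∷ []) (v₀ ⊖ v₁) (⊝ (v₁ ⊖ v₀)) ≡.refl)

    chain : ∀ i {x y z} → P i (x -[ i ] y) → P i (y -[ i ] z) → P i (x -[ i ] z)
    chain i p q = mem i (clo-+ i _ _ p q)
      (At.solve i (_ ∷ _ ∷ _ ∷ []) (v₀ ⊖ v₂) (v₀ ⊖ v₁ ⊕ (v₁ ⊖ v₂)) ≡.refl)

    drop : ∀ i {x y} → P i (x -[ i ] y) → P i y → P i x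
    drop i p q = mem i (clo-+ i _ _ p q)
      (At.solve i (_ ∷ _ ∷ []) v₀ (v₀ ⊖ v₁ ⊕ v₁) ≡.refl)

    minus-0 : ∀ i {x} → P i x → P i (x -[ i ] 0[ i ])
    minus-0 i p = mem i p (At.solve i (_ ∷ []) (v₀ ⊖ 𝟘) v₀ ≡.refl)

    minus-0⁻¹ : ∀ i {x} → P i (x -[ i ] 0[ i ]) → P i x
    minus-0⁻¹ i p = mem i p (At.solve i (_ ∷ []) v₀ (v₀ ⊖ 𝟘) ≡.refl)

  module SubQuotient (V : Family) {L : Graded.Op⁺ E V} (L-linear : Graded.Linear⁺ E V L)
                     {In Next : Graded.SubPred E V}
                     (in-sub : Graded.IsSubobject E V L In)
                     (next-sub : Graded.IsSubobject E V L Next) where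
    open Graded E V
    private
      module I = Subobject in-sub
      module N = Subobject next-sub
      module At i = ModuleLemmas (V i)
      module L = Linear⁺ L-linear

    -- The quotient is formed by coarsening equality, so its elements are the same representatives
    -- on which the filtration and `ΛG` are stated.
    subquotient : Family
    subquotient i = record
      { Carrierᴹ = Σ (C i) (In i)
      ; _≈ᴹ_     = λ (x , _) (y , _) → Next i (x -[ i ] y)
      ; _+ᴹ_     = λ (x , p) (y , q) → x +ᴹ y , I.clo-+ i x y p q
      ; _*ₗ_     = λ c (x , p) → c *ₗ x , I.clo-· i c x p
      ; 0ᴹ       = 0ᴹ , I.has-0 i
      ; -ᴹ_      = λ (x , p) → -ᴹ x , I.clo-neg i p
      ; isLeftModule = record
        { isLeftSemimodule = record
          { +ᴹ-isCommutativeMonoid = record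
            { isMonoid = record
              { isSemigroup = record
                { isMagma = record
                  { isEquivalence = record
                    { refl  = N.≈⇒mem i ≈ᴹ-refl
                    ; sym   = N.swap i
                    ; trans = N.chain i
                    }
                  ; ∙-cong = sum-cong
                  }
                ; assoc = λ _ _ _ → N.≈⇒mem i (+ᴹ-assoc _ _ _)
                }
              ; identity = (λ _ → N.≈⇒mem i (+ᴹ-identityˡ _)) , (λ _ → N.≈⇒mem i (+ᴹ-identityʳ _))
              }
            ; comm = λ _ _ → N.≈⇒mem i (+ᴹ-comm _ _)
            }
          ; isPreleftSemimodule = record
            { *ₗ-cong      = λ {c} {c′} c≈c′ p →
                N.mem i (N.clo-· i c _ p)
                  (≈ᴹ-trans (-ᴹ-cong ≈ᴹ-refl (*ₗ-congʳ (sym c≈c′))) (≈ᴹ-sym (*ₗ-hom-minus c _ _)))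
            ; *ₗ-zeroˡ     = λ _ → N.≈⇒mem i (*ₗ-zeroˡ _)
            ; *ₗ-distribʳ  = λ _ _ _ → N.≈⇒mem i (*ₗ-distribʳ _ _ _)
            ; *ₗ-identityˡ = λ _ → N.≈⇒mem i (*ₗ-identityˡ _)
            ; *ₗ-assoc     = λ _ _ _ → N.≈⇒mem i (*ₗ-assoc _ _ _)
            ; *ₗ-zeroʳ     = λ _ → N.≈⇒mem i (*ₗ-zeroʳ _)
            ; *ₗ-distribˡ  = λ _ _ _ → N.≈⇒mem i (*ₗ-distribˡ _ _ _)
            }
          }
        ; -ᴹ‿cong = λ p → N.mem i (N.clo-neg i p)
            (solve (_ ∷ _ ∷ []) (⊝ v₀ ⊖ ⊝ v₁) (⊝ (v₀ ⊖ v₁)) ≡.refl)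
        ; -ᴹ‿inverse = (λ _ → N.≈⇒mem i (-ᴹ‿inverseˡ _)) , (λ _ → N.≈⇒mem i (-ᴹ‿inverseʳ _))
        }
      }
      where
      open At i
      sum-cong : ∀ {x y z w} → Next i (x -[ i ] y) → Next i (z -[ i ] w) →
               Next i ((x +[ i ] z) -[ i ] (y +[ i ] w))
      sum-cong p q = N.mem i (N.clo-+ i _ _ p q)
        (solve (_ ∷ _ ∷ _ ∷ _ ∷ []) (v₀ ⊕ v₂ ⊖ (v₁ ⊕ v₃)) (v₀ ⊖ v₁ ⊕ (v₂ ⊖ v₃)) ≡.refl)

    L-linear-mod : ∀ i {x y} → Next i (x -[ i ] y) → Next (i ℤ.+ 1ℤ) (L i x -[ i ℤ.+ 1ℤ ] L i y)
    L-linear-mod i p = N.mem (i ℤ.+ 1ℤ) (N.clo-L i _ p) (At.≈ᴹ-sym _ (LinearMap.hom-minus L-map _ _))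
      where
      L-map : LinearMap (V i) (V (i ℤ.+ 1ℤ))
      L-map = record { apply = L i ; cong = L.cong i ; hom-+ = L.hom-+ i ; hom-· = L.hom-· i }

    subquotient-above : ∀ {B r} → VanishesAbove B V r → VanishesAbove B subquotient r
    subquotient-above above i r≤i+B (x , _) = N.minus-0 i (N.mem-0 i (above i r≤i+B x))

    subquotient-below : ∀ {B} → VanishesBelow B V → VanishesBelow B subquotient
    subquotient-below below i i+B<0 (x , _) = N.minus-0 i (N.mem-0 i (below i i+B<0 x))

    -- `IsLambdaG` for an arbitrary pair `In`, `Next`, in order to cover the kernel and cokernel of
    -- b along with the three graded pieces.
    record IsLambdaOn (k : ℤ) (Λ : ∀ i (x : C (i ℤ.+ 1ℤ)) → In (i ℤ.+ 1ℤ) x → C i) : Set where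
      field
        into  : ∀ i x p → In i (Λ i x p)
        wd    : ∀ i x y p q → Next (i ℤ.+ 1ℤ) (x -[ i ℤ.+ 1ℤ ] y) → Next i (Λ i x p -[ i ] Λ i y q)
        hom-+ : ∀ i x y p q → Next i (Λ i (x +[ i ℤ.+ 1ℤ ] y) (I.clo-+ (i ℤ.+ 1ℤ) x y p q)
                                        -[ i ] (Λ i x p +[ i ] Λ i y q))
        hom-· : ∀ i c x p → Next i (Λ i (c ·[ i ℤ.+ 1ℤ ] x) (I.clo-· (i ℤ.+ 1ℤ) c x p)
                                      -[ i ] (c ·[ i ] Λ i x p))
        comm  : ∀ i x (p : In (i ℤ.+ 1ℤ) x) → Next (i ℤ.+ 1ℤ)
          ((Λ (i ℤ.+ 1ℤ) (L (i ℤ.+ 1ℤ) x) (I.clo-L (i ℤ.+ 1ℤ) x p) -[ i ℤ.+ 1ℤ ] L i (Λ i x p))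
            -[ i ℤ.+ 1ℤ ] (ℤ→E E (k ℤ.- (+ 2 ℤ.* (i ℤ.+ 1ℤ))) ·[ i ℤ.+ 1ℤ ] x))

    sl2-subquotient : ∀ {k Λ} → IsLambdaOn k Λ → Sl2Module k
    sl2-subquotient {Λ = Λ} isΛ = record
      { family   = subquotient
      ; L        = λ i (x , p) → L i x , I.clo-L i x p
      ; Λ        = λ i (x , p) → Λ i x p , isΛ.into i x p
      ; L-linear = record
        { cong  = λ i _ _ → L-linear-mod i
        ; hom-+ = λ i _ _ → N.≈⇒mem _ (L.hom-+ i _ _)
        ; hom-· = λ i _ _ → N.≈⇒mem _ (L.hom-· i _ _)
        }
      ; Λ-spec = record
        { linear = record
          { cong  = λ i (x , p) (y , q) → isΛ.wd i x y p q
          ; hom-+ = λ i (x , p) (y , q) → isΛ.hom-+ i x y p q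
          ; hom-· = λ i c (x , p) → isΛ.hom-· i c x p
          }
        ; comm = λ i (x , p) → isΛ.comm i x p
        }
      }
      where module isΛ = IsLambdaOn isΛ

  all-sub : ∀ {V} {L : Graded.Op⁺ E V} → Graded.IsSubobject E V L (Graded.All E V)
  all-sub = record
    { resp = λ _ _ _ _ _ → tt ; has-0 = λ _ → tt ; clo-+ = λ _ _ _ _ _ → tt
    ; clo-· = λ _ _ _ _ → tt ; clo-L = λ _ _ _ → tt }

  zero-sub : ∀ {V} {L : Graded.Op⁺ E V} → Graded.Linear⁺ E V L →
             Graded.IsSubobject E V L (Graded.Zero E V)
  zero-sub {V} {L} L-linear = record
    { resp  = λ i _ _ x≈y x≈0 → At.≈ᴹ-trans i (At.≈ᴹ-sym i x≈y) x≈0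
    ; has-0 = λ i → At.≈ᴹ-refl i
    ; clo-+ = λ i _ _ p q → At.≈ᴹ-trans i (At.+ᴹ-cong i p q) (At.+ᴹ-identityˡ i _)
    ; clo-· = λ i c _ p → At.≈ᴹ-trans i (At.*ₗ-congˡ i p) (At.*ₗ-zeroʳ i c)
    ; clo-L = λ i _ p → At.≈ᴹ-trans _ (L.cong i _ _ p) (LinearMap.hom-0 (L-map i))
    }
    where
    module At i = ModuleLemmas (V i)
    module L = Graded.Linear⁺ L-linear
    L-map : ∀ i → LinearMap (V i) (V (i ℤ.+ 1ℤ))
    L-map i = record { apply = L i ; cong = L.cong i ; hom-+ = L.hom-+ i ; hom-· = L.hom-· i }

  zero-Λ : ∀ {k} (M : Sl2Module k) i x →
           Sl2Module.Zero M (i ℤ.+ 1ℤ) x → Sl2Module.Zero M i (Sl2Module.Λ M i x)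
  zero-Λ M i x x≈0 = At.≈ᴹ-trans i (LinearMap.cong (Λ-map i) _ _ x≈0) (LinearMap.hom-0 (Λ-map i))
    where open Sl2Module M

  module StableSubQuotient {k : ℤ} (M : Sl2Module k) {In Next : Sl2Module.SubPred M}
    (in-sub : Sl2Module.IsSubobject M (Sl2Module.L M) In)
    (next-sub : Sl2Module.IsSubobject M (Sl2Module.L M) Next)
    (in-Λ : ∀ i x → In (i ℤ.+ 1ℤ) x → In i (Sl2Module.Λ M i x))
    (next-Λ : ∀ i x → Next (i ℤ.+ 1ℤ) x → Next i (Sl2Module.Λ M i x)) where
    private
      module M = Sl2Module M
      module N = Subobject next-sub
      module Λ i = LinearMap (M.Λ-map i)

    module SQ = SubQuotient M.family M.L-linear in-sub next-sub

    subquotient : Sl2Module k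
    subquotient = SQ.sl2-subquotient {Λ = λ i x _ → M.Λ i x} record
      { into  = in-Λ
      ; wd    = λ i x y _ _ p → N.mem i (next-Λ i _ p) (M.At.≈ᴹ-sym i (Λ.hom-minus i x y))
      ; hom-+ = λ i x y _ _ → N.≈⇒mem i (Λ.hom-+ i x y)
      ; hom-· = λ i c x _ → N.≈⇒mem i (Λ.hom-· i c x)
      ; comm  = λ i x _ → N.≈⇒mem _ (M.IsLambda.comm M.Λ-spec i x)
      }

  -- 2B + 1 counts the degrees from -B to B.
  bounded⇒above : ∀ V (b : Graded.Bounded E V) → VanishesAbove (proj₁ b) V (suc (proj₁ b ℕ.+ proj₁ b))
  bounded⇒above V (B , vanish) (+ k)    le =
    vanish (+ k) (ℕₚ.+-cancelʳ-≤ B (suc B) k (ℤₚ.drop‿+≤+ le))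
  bounded⇒above V (B , vanish) -[1+ k ] le with
    ℕₚ.m+n≮m B B (ℤₚ.drop‿+≤+ (ℤₚ.≤-trans le (ℤₚ.m⊖n≤m B (suc k))))
  ... | ()

  bounded⇒below : ∀ V (b : Graded.Bounded E V) → VanishesBelow (proj₁ b) V
  bounded⇒below V (B , vanish) (+ k)    (ℤ.+<+ ())
  bounded⇒below V (B , vanish) -[1+ k ] lt = vanish -[1+ k ] (ℕₚ.≰⇒> λ 1+k≤B →
    ℤₚ.<⇒≱ lt (≡.subst (+ 0 ℤ.≤_) (≡.sym (ℤₚ.⊖-≥ 1+k≤B)) (ℤ.+≤+ ℕ.z≤n)))

  -- The bound is not sharp, but it lets one pair `B`, `r` serve shifted and unshifted sources
  -- alike.
  shifted-above : ∀ {B r} (V : Family) → VanishesAbove B V r → VanishesAbove B (λ i → V (i ℤ.+ 1ℤ)) r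
  shifted-above {B} V above i r≤i+B = above (i ℤ.+ 1ℤ)
    (ℤₚ.≤-trans r≤i+B (ℤₚ.+-monoˡ-≤ (+ B) (ℤₚ.i≤i+j i 1ℤ)))

  -- The graded pieces, the map b, and its injectivity.

  module Bijectivity (V : Family) (n : ℤ) (H : Setup.Hypotheses E V n) where
    open Setup E V
    open Hypotheses H
    module At i = ModuleLemmas (V i)

    VM : Sl2Module (n ℤ.+ 1ℤ)
    VM = record { family = V ; L = L ; Λ = Λ ; L-linear = L-linear ; Λ-spec = Λ-spec }

    module L-map i = LinearMap (Sl2Module.L-map VM i)
    module Λ-map i = LinearMap (Sl2Module.Λ-map VM i)

    module Z = Subobject (zero-sub L-linear)
    module F1 = Subobject F1-sub
    module F2 = Subobject F2-sub

    module SQ0 = SubQuotient V L-linear all-sub F1-sub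
    module SQ1 = SubQuotient V L-linear F1-sub F2-sub
    module SQ2 = SubQuotient V L-linear F2-sub (zero-sub L-linear)

    GM0 : Sl2Module (n ℤ.+ + 0)
    GM0 = SQ0.sl2-subquotient (record { IsLambdaG (ΛG-spec g0) })

    GM1 : Sl2Module (n ℤ.+ + 1)
    GM1 = SQ1.sl2-subquotient (record { IsLambdaG (ΛG-spec g1) })

    GM2 : Sl2Module (n ℤ.+ + 2)
    GM2 = SQ2.sl2-subquotient (record { IsLambdaG (ΛG-spec g2) })

    B r : ℕ
    B = proj₁ V-bounded
    r = suc (B ℕ.+ B)

    V-above : VanishesAbove B V r
    V-above = bounded⇒above V V-bounded

    V-below : VanishesBelow B V
    V-below = bounded⇒below V V-bounded

    Λ₀ : Op⁻
    Λ₀ i x = ΛG g0 i x tt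

    Λ₂ : ∀ i (y : C (i ℤ.+ 1ℤ)) → F2 (i ℤ.+ 1ℤ) y → C i
    Λ₂ = ΛG g2

    Λ₂-F2 : ∀ i y p → F2 i (Λ₂ i y p)
    Λ₂-F2 = IsLambdaG.into (ΛG-spec g2)

    module Λ₀-map i = LinearMap (Sl2Module.Λ-map GM0 i)
    module Λ₂-map i = LinearMap (Sl2Module.Λ-map GM2 i)

    Λ₀-cong : ∀ i {x y} → F1 (i ℤ.+ 1ℤ) (x -[ i ℤ.+ 1ℤ ] y) → F1 i (Λ₀ i x -[ i ] Λ₀ i y)
    Λ₀-cong i p = Λ₀-map.cong i (_ , tt) (_ , tt) p

    Λ₀-F1 : ∀ i {x} → F1 (i ℤ.+ 1ℤ) x → F1 i (Λ₀ i x)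
    Λ₀-F1 i p = F1.drop i (Λ₀-cong i (F1.minus-0 _ p)) (F1.minus-0⁻¹ i (Λ₀-map.hom-0 i))

    weight : ∀ i (x : C (i ℤ.+ 1ℤ)) → C (i ℤ.+ 1ℤ)
    weight i x = ℤ→E E (n ℤ.+ 1ℤ ℤ.- (+ 2 ℤ.* (i ℤ.+ 1ℤ))) ·[ i ℤ.+ 1ℤ ] x

    [Λ,L] : ∀ i x → (Λ (i ℤ.+ 1ℤ) (L (i ℤ.+ 1ℤ) x) -[ i ℤ.+ 1ℤ ] L i (Λ i x)) ≈[ i ℤ.+ 1ℤ ] weight i x
    [Λ,L] = IsLambda.comm Λ-spec

    -- The commutator acts by a scalar in each degree and so preserves every subobject. This is why
    -- maps induced by Λ on subquotients are L-linear.
    [Λ,L]-mem : ∀ {P} → IsSubobject L P → ∀ i x → P (i ℤ.+ 1ℤ) x →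
      P (i ℤ.+ 1ℤ) (Λ (i ℤ.+ 1ℤ) (L (i ℤ.+ 1ℤ) x) -[ i ℤ.+ 1ℤ ] L i (Λ i x))
    [Λ,L]-mem sub i x p = P.mem _ (P.clo-· _ _ x p) ([Λ,L] i x)
      where module P = Subobject sub

    -- b is Λ modulo F1 on F2; in degree-0 form it is defined on the shift of GM2.
    b : Hom.Hom GM0 (Sl2Module.family (shifted GM2))
    b i = record
      { apply = λ (y , _) → Λ i y , tt
      ; cong  = λ _ _ y≈y′ → F1.≈⇒mem i (Λ-map.cong i _ _ (At.difference≈0⇒≈ _ _ _ y≈y′))
      ; hom-+ = λ _ _ → F1.≈⇒mem i (Λ-map.hom-+ i _ _)
      ; hom-· = λ _ _ → F1.≈⇒mem i (Λ-map.hom-· i _ _)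
      }

    -- b is L-linear, and the shift brings twice the center of G² from n + 2 down to n, that of G⁰.
    -- So w = 0, and [Λ, b] vanishes.
    b-Λ-linear : ∀ i y p → F1 i (Λ₀ i (Λ (i ℤ.+ 1ℤ) y) -[ i ] Λ i (Λ₂ (i ℤ.+ 1ℤ) y p))
    b-Λ-linear i y p = F1.minus-0⁻¹ i
      (adΛ-vanishes (SQ0.subquotient-below V-below) r {w = 0} {d = 0} (shifted GM2) b (weights n)
        (defect-commutes⇒eigen (shifted GM2) b 0
          (linear⇒defect-commutes (shifted GM2) b
            λ j (z , q) → F1.minus-0 _ ([Λ,L]-mem F1-sub j z (F2⊆F1 _ z q))))
        (shifted-above (Sl2Module.family GM2) (SQ2.subquotient-above V-above))
        i (y , p))
      where
      open Hom GM0
      weights : ∀ n → n ℤ.+ + 0 ≡ n ℤ.+ + 2 ℤ.- + 2 ℤ.+ + 0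
      weights = solve-∀

    Ker : Sl2Module.SubPred (shifted GM2)
    Ker i (y , _) = F1 i (Λ i y)

    Ker-sub : Sl2Module.IsSubobject (shifted GM2) (Sl2Module.L (shifted GM2)) Ker
    Ker-sub = record
      { resp  = λ i _ _ y≈y′ → F1.resp i _ _ (Λ-map.cong i _ _ (At.difference≈0⇒≈ _ _ _ y≈y′))
      ; has-0 = λ i → F1.mem-0 i (Λ-map.hom-0 i)
      ; clo-+ = λ i _ _ p q → F1.mem i (F1.clo-+ i _ _ p q) (Λ-map.hom-+ i _ _)
      ; clo-· = λ i c _ p → F1.mem i (F1.clo-· i c _ p) (Λ-map.hom-· i c _)
      ; clo-L = λ i (y , y∈F2) p →
          F1.drop _ ([Λ,L]-mem F1-sub i y (F2⊆F1 _ y y∈F2)) (F1.clo-L i _ p)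
      }

    -- Λ-linearity of b moves Λ₂ on the kernel to Λ₀ on F¹, which is zero in G⁰.
    Ker-Λ : ∀ i y → Ker (i ℤ.+ 1ℤ) y → Ker i (Sl2Module.Λ (shifted GM2) i y)
    Ker-Λ i (y , y∈F2) p = F1.drop i (F1.swap i (b-Λ-linear i y y∈F2)) (Λ₀-F1 i p)

    module Kernel = StableSubQuotient (shifted GM2) Ker-sub (zero-sub (Sl2Module.L-linear (shifted GM2)))
      Ker-Λ (zero-Λ (shifted GM2))

    KM : Sl2Module (n ℤ.+ + 2 ℤ.- + 2)
    KM = Kernel.subquotient

    KM-above : VanishesAbove B (Sl2Module.family KM) r
    KM-above = Kernel.SQ.subquotient-above
      (shifted-above (Sl2Module.family GM2) (SQ2.subquotient-above V-above))

    KM-≈ : ∀ i {x x′} → LeftModule._≈ᴹ_ (Sl2Module.family KM i) x x′ →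
           proj₁ (proj₁ x) ≈[ i ℤ.+ 1ℤ ] proj₁ (proj₁ x′)
    KM-≈ i p = At.difference≈0⇒≈ _ _ _ (Z.minus-0⁻¹ _ p)

    -- On ker b the values of Λ lie in F¹. Their classes in G¹ form an L-linear map along which
    -- twice the center grows from n to n + 1, so it vanishes.
    Λ-Ker⊆F2 : ∀ i y → F2 (i ℤ.+ 1ℤ) y → F1 i (Λ i y) → F2 i (Λ i y)
    Λ-Ker⊆F2 i y p q = F2.minus-0⁻¹ i
      (vanishes (SQ1.subquotient-below V-below) r {d = 0} KM c (weights n)
        (defect-commutes⇒eigen KM c 1
          (linear⇒defect-commutes KM c
            λ j ((z , z∈F2) , _) → F2.minus-0 _ ([Λ,L]-mem F2-sub j z z∈F2)))
        KM-above i ((y , p) , q))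
      where
      open Hom GM1
      c : Hom (Sl2Module.family KM)
      c i = record
        { apply = λ ((y , _) , p) → Λ i y , p
        ; cong  = λ x x′ x≈x′ → F2.≈⇒mem i (Λ-map.cong i _ _ (KM-≈ i {x} {x′} x≈x′))
        ; hom-+ = λ _ _ → F2.≈⇒mem i (Λ-map.hom-+ i _ _)
        ; hom-· = λ _ _ → F2.≈⇒mem i (Λ-map.hom-· i _ _)
        }
      weights : ∀ n → n ℤ.+ + 1 ≡ n ℤ.+ + 2 ℤ.- + 2 ℤ.+ + 1
      weights = solve-∀

    D : ∀ i y → F2 (i ℤ.+ 1ℤ) y → C i
    D i y p = Λ i y -[ i ] Λ₂ i y p

    Λ₂-cong : ∀ i {y y′ p p′} → y ≈[ i ℤ.+ 1ℤ ] y′ → Λ₂ i y p ≈[ i ] Λ₂ i y′ p′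
    Λ₂-cong i y≈y′ = At.difference≈0⇒≈ i _ _
      (IsLambdaG.wd (ΛG-spec g2) i _ _ _ _ (Z.≈⇒mem _ y≈y′))

    D-cong : ∀ i {y y′ p p′} → y ≈[ i ℤ.+ 1ℤ ] y′ → D i y p ≈[ i ] D i y′ p′
    D-cong i y≈y′ = At.-ᴹ-cong i (Λ-map.cong i _ _ y≈y′) (Λ₂-cong i y≈y′)

    D-hom-+ : ∀ i y y′ p p′ → D i (y +[ i ℤ.+ 1ℤ ] y′) (F2.clo-+ _ y y′ p p′) ≈[ i ] (D i y p +[ i ] D i y′ p′)
    D-hom-+ i y y′ p p′ = ≈ᴹ-trans
      (-ᴹ-cong (Λ-map.hom-+ i y y′) (difference≈0⇒≈ _ _ (Λ₂-map.hom-+ i (y , p) (y′ , p′))))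
      (solve (_ ∷ _ ∷ _ ∷ _ ∷ []) (v₀ ⊕ v₁ ⊖ (v₂ ⊕ v₃)) (v₀ ⊖ v₂ ⊕ (v₁ ⊖ v₃)) ≡.refl)
      where open At i

    D-hom-· : ∀ i c y p → D i (c ·[ i ℤ.+ 1ℤ ] y) (F2.clo-· _ c y p) ≈[ i ] (c ·[ i ] D i y p)
    D-hom-· i c y p = ≈ᴹ-trans
      (-ᴹ-cong (Λ-map.hom-· i c y) (difference≈0⇒≈ _ _ (Λ₂-map.hom-· i c (y , p))))
      (≈ᴹ-sym (*ₗ-hom-minus c _ _))
      where open At i

    -- The centers of V and of the graded piece differ by 1/2.
    [D,L] : ∀ i y p → (D (i ℤ.+ 1ℤ) (L (i ℤ.+ 1ℤ) y) (F2.clo-L _ y p) -[ i ℤ.+ 1ℤ ] L i (D i y p))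
                        ≈[ i ℤ.+ 1ℤ ] LeftModule.-ᴹ_ (V (i ℤ.+ 1ℤ)) y
    [D,L] i y p = begin
      (a -ᴹ b′) -ᴹ L i (D i y p)
        ≈⟨ -ᴹ-cong ≈ᴹ-refl (L-map.hom-minus i _ _) ⟩
      (a -ᴹ b′) -ᴹ (c -ᴹ d)
        ≈⟨ solve (a ∷ b′ ∷ c ∷ d ∷ []) (v₀ ⊖ v₁ ⊖ (v₂ ⊖ v₃)) (v₀ ⊖ v₂ ⊖ (v₁ ⊖ v₃)) ≡.refl ⟩
      (a -ᴹ c) -ᴹ (b′ -ᴹ d)
        ≈⟨ -ᴹ-cong ([Λ,L] i y) (≈ᴹ-trans (difference≈0⇒≈ _ _ (IsLambdaG.comm (ΛG-spec g2) i y p))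
                                          (ℤ→E-scale-suc {b = n ℤ.+ 1ℤ ℤ.- (+ 2 ℤ.* (i ℤ.+ 1ℤ))} (weights n i) y)) ⟩
      weight i y -ᴹ (weight i y +ᴹ y)
        ≈⟨ solve (weight i y ∷ y ∷ []) (v₀ ⊖ (v₀ ⊕ v₁)) (⊝ v₁) ≡.refl ⟩
      -ᴹ y ∎
      where
      open At (i ℤ.+ 1ℤ)
      a = Λ (i ℤ.+ 1ℤ) (L (i ℤ.+ 1ℤ) y)
      b′ = Λ₂ (i ℤ.+ 1ℤ) (L (i ℤ.+ 1ℤ) y) (F2.clo-L _ y p)
      c = L i (Λ i y)
      d = L i (Λ₂ i y p)
      weights : ∀ n i → n ℤ.+ + 2 ℤ.- (+ 2 ℤ.* (i ℤ.+ 1ℤ)) ≡ n ℤ.+ 1ℤ ℤ.- (+ 2 ℤ.* (i ℤ.+ 1ℤ)) ℤ.+ 1ℤ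
      weights = solve-∀

    Λ₂-neg : ∀ i {y p y′ p′} → y ≈[ i ℤ.+ 1ℤ ] LeftModule.-ᴹ_ (V (i ℤ.+ 1ℤ)) y′ →
             Λ₂ i y p ≈[ i ] LeftModule.-ᴹ_ (V i) (Λ₂ i y′ p′)
    Λ₂-neg i {p′ = p′} y≈-y′ = At.≈ᴹ-trans i
      (Λ₂-cong i {p′ = F2.clo-neg _ p′} y≈-y′)
      (At.difference≈0⇒≈ i _ _ (Λ₂-map.hom-neg i (_ , p′)))

    -- By `Λ-Ker⊆F2`, `D` maps ker b into F², and twice the center grows from n to n + 2. Its defect
    -- is minus the inclusion, which commutes with Λ₂. Hence `D` vanishes on ker b, its defect
    -- vanishes too, and so does the inclusion.
    b-injective : ∀ i y → F2 (i ℤ.+ 1ℤ) y → F1 i (Λ i y) → y ≈[ i ℤ.+ 1ℤ ] 0[ i ℤ.+ 1ℤ ]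
    b-injective i y p q = begin
      y            ≈⟨ solve (y ∷ []) v₀ (⊝ ⊝ v₀) ≡.refl ⟩
      -ᴹ (-ᴹ y)    ≈⟨ -ᴹ‿cong ([D,L] i y p) ⟨
      -ᴹ proj₁ (defect KM D-map i ((y , p) , q))
                   ≈⟨ -ᴹ‿cong (Z.minus-0⁻¹ _ (defect-zero KM D-map D-vanishes i ((y , p) , q))) ⟩
      -ᴹ 0ᴹ        ≈⟨ solve [] (⊝ 𝟘) 𝟘 ≡.refl ⟩
      0ᴹ           ∎
      where
      open At (i ℤ.+ 1ℤ)
      open Hom GM2
      D-map : Hom (Sl2Module.family KM)
      D-map i = record
        { apply = λ ((y , p) , q) → D i y p , F2.clo-minus i (Λ-Ker⊆F2 i y p q) (Λ₂-F2 i y p)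
        ; cong  = λ x x′ x≈x′ → Z.≈⇒mem i (D-cong i (KM-≈ i {x} {x′} x≈x′))
        ; hom-+ = λ ((y , p) , _) ((y′ , p′) , _) → Z.≈⇒mem i (D-hom-+ i y y′ p p′)
        ; hom-· = λ c ((y , p) , _) → Z.≈⇒mem i (D-hom-· i c y p)
        }
      weights : ∀ n → n ℤ.+ + 2 ≡ n ℤ.+ + 2 ℤ.- + 2 ℤ.+ + 2
      weights = solve-∀
      D-vanishes : IsZero D-map
      D-vanishes = vanishes (SQ2.subquotient-below V-below) r {d = 1} KM D-map (weights n)
        (defect-commutes⇒eigen KM D-map 2 λ j ((z , z∈F2) , _) → Z.≈⇒mem _
          (At.≈ᴹ-trans _ (Λ₂-neg _ ([D,L] _ z z∈F2))
            (At.≈ᴹ-sym _ ([D,L] j (Λ₂ (j ℤ.+ 1ℤ) z z∈F2) (Λ₂-F2 _ z z∈F2)))))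
        KM-above

    -- Surjectivity of b, dual to injectivity.

    Ran : Sl2Module.SubPred GM0
    Ran i (v , _) = Σ[ y ∈ C (i ℤ.+ 1ℤ) ] (F2 (i ℤ.+ 1ℤ) y × F1 i (v -[ i ] Λ i y))

    F1⊆Ran : ∀ i {v} → F1 i v → Ran i (v , tt)
    F1⊆Ran i p = 0[ i ℤ.+ 1ℤ ] , F2.has-0 _ ,
      F1.clo-minus i p (F1.mem-0 i (Λ-map.hom-0 i))

    Ran-sub : Sl2Module.IsSubobject GM0 (Sl2Module.L GM0) Ran
    Ran-sub = record
      { resp  = λ i _ _ v≈v′ (y , p , q) → y , p , F1.chain i (F1.swap i v≈v′) q
      ; has-0 = λ i → F1⊆Ran i (F1.has-0 i)
      ; clo-+ = λ i _ _ (y , p , q) (y′ , p′ , q′) → _ , F2.clo-+ _ y y′ p p′ ,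
          F1.mem i (F1.clo-+ i _ _ q q′) (At.≈ᴹ-trans i
            (At.-ᴹ-cong i (At.≈ᴹ-refl i) (Λ-map.hom-+ i y y′))
            (At.solve i (_ ∷ _ ∷ _ ∷ _ ∷ []) (v₀ ⊕ v₁ ⊖ (v₂ ⊕ v₃)) (v₀ ⊖ v₂ ⊕ (v₁ ⊖ v₃)) ≡.refl))
      ; clo-· = λ i c _ (y , p , q) → _ , F2.clo-· _ c y p ,
          F1.mem i (F1.clo-· i c _ q) (At.≈ᴹ-trans i
            (At.-ᴹ-cong i (At.≈ᴹ-refl i) (Λ-map.hom-· i c y))
            (At.≈ᴹ-sym i (At.*ₗ-hom-minus i c _ _)))
      ; clo-L = λ i _ (y , p , q) → L (i ℤ.+ 1ℤ) y , F2.clo-L _ y p ,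
          F1.chain _ (SQ0.L-linear-mod i q) (F1.swap _ ([Λ,L]-mem F1-sub i y (F2⊆F1 _ y p)))
      }

    Ran-Λ : ∀ i v → Ran (i ℤ.+ 1ℤ) v → Ran i (Sl2Module.Λ GM0 i v)
    Ran-Λ i _ (y , p , q) = Λ₂ (i ℤ.+ 1ℤ) y p , Λ₂-F2 _ y p ,
      F1.chain i (Λ₀-cong i q) (b-Λ-linear i y p)

    module Cokernel = StableSubQuotient GM0 all-sub Ran-sub (λ _ _ _ → tt) Ran-Λ

    QM : Sl2Module (n ℤ.+ + 0)
    QM = Cokernel.subquotient

    QM-below : VanishesBelow B (Sl2Module.family QM)
    QM-below = Cokernel.SQ.subquotient-below (SQ0.subquotient-below V-below)

    module Ran = Subobject Ran-sub

    -- Λ carries F² into `Ran`, each element being its own witness, so Λ induces a map from G¹ to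
    -- coker b. It is L-linear, and twice the center grows from n - 1 (after the shift) to n, so it
    -- vanishes.
    ΛF1⊆Ran : ∀ i x → F1 (i ℤ.+ 1ℤ) x → Ran i (Λ i x , tt)
    ΛF1⊆Ran i x p = Ran.minus-0⁻¹ i {Λ i x , tt}
      (vanishes QM-below r {d = 0} (shifted GM1) c (weights n)
        (defect-commutes⇒eigen (shifted GM1) c 1
          (linear⇒defect-commutes (shifted GM1) c λ j (z , z∈F1) →
            Ran.minus-0 _ {_ , tt} (F1⊆Ran _ ([Λ,L]-mem F1-sub j z z∈F1))))
        (shifted-above (Sl2Module.family GM1) (SQ1.subquotient-above V-above))
        i (x , p))
      where
      open Hom QM
      c : Hom (Sl2Module.family (shifted GM1))
      c i = record
        { apply = λ (x , _) → (Λ i x , tt) , tt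
        ; cong  = λ (x , _) (x′ , _) x-x′∈F2 → x -[ i ℤ.+ 1ℤ ] x′ , x-x′∈F2 ,
            F1.≈⇒mem i (At.≈ᴹ-sym i (Λ-map.hom-minus i x x′))
        ; hom-+ = λ _ _ → F1⊆Ran i (F1.≈⇒mem i (Λ-map.hom-+ i _ _))
        ; hom-· = λ _ _ → F1⊆Ran i (F1.≈⇒mem i (Λ-map.hom-· i _ _))
        }
      weights : ∀ n → n ℤ.+ + 0 ≡ n ℤ.+ + 1 ℤ.- + 2 ℤ.+ + 1
      weights = solve-∀

    D₀ : Op⁻
    D₀ i x = Λ i x -[ i ] Λ₀ i x

    -- The weights of V exceed those of G⁰ by 1, which gives the identity with sign opposite to that
    -- in `[D,L]`.
    [D₀,L] : ∀ i x → F1 (i ℤ.+ 1ℤ) ((D₀ (i ℤ.+ 1ℤ) (L (i ℤ.+ 1ℤ) x) -[ i ℤ.+ 1ℤ ] L i (D₀ i x))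
                                      -[ i ℤ.+ 1ℤ ] x)
    [D₀,L] i x = F1.mem _ (F1.clo-neg _ (IsLambdaG.comm (ΛG-spec g0) i x tt)) (begin
      (a -ᴹ b′) -ᴹ L i (D₀ i x) -ᴹ x
        ≈⟨ -ᴹ-cong (-ᴹ-cong ≈ᴹ-refl (L-map.hom-minus i _ _)) ≈ᴹ-refl ⟩
      (a -ᴹ b′) -ᴹ (c -ᴹ d) -ᴹ x
        ≈⟨ solve (a ∷ b′ ∷ c ∷ d ∷ x ∷ []) (v₀ ⊖ v₁ ⊖ (v₂ ⊖ v₃) ⊖ v₄) (v₀ ⊖ v₂ ⊖ (v₁ ⊖ v₃) ⊖ v₄) ≡.refl ⟩
      (a -ᴹ c) -ᴹ (b′ -ᴹ d) -ᴹ x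
        ≈⟨ -ᴹ-cong (-ᴹ-cong (≈ᴹ-trans ([Λ,L] i x) (ℤ→E-scale-suc {b = k} (weights n i) x)) ≈ᴹ-refl) ≈ᴹ-refl ⟩
      (ℤ→E E k *ₗ x +ᴹ x) -ᴹ (b′ -ᴹ d) -ᴹ x
        ≈⟨ solve (ℤ→E E k *ₗ x ∷ x ∷ b′ ∷ d ∷ []) (v₀ ⊕ v₁ ⊖ (v₂ ⊖ v₃) ⊖ v₁) (⊝ (v₂ ⊖ v₃ ⊖ v₀)) ≡.refl ⟩
      -ᴹ (b′ -ᴹ d -ᴹ ℤ→E E k *ₗ x) ∎)
      where
      open At (i ℤ.+ 1ℤ)
      k = n ℤ.+ + 0 ℤ.- (+ 2 ℤ.* (i ℤ.+ 1ℤ))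
      a = Λ (i ℤ.+ 1ℤ) (L (i ℤ.+ 1ℤ) x)
      b′ = Λ₀ (i ℤ.+ 1ℤ) (L (i ℤ.+ 1ℤ) x)
      c = L i (Λ i x)
      d = L i (Λ₀ i x)
      weights : ∀ n i → n ℤ.+ 1ℤ ℤ.- (+ 2 ℤ.* (i ℤ.+ 1ℤ)) ≡ n ℤ.+ + 0 ℤ.- (+ 2 ℤ.* (i ℤ.+ 1ℤ)) ℤ.+ 1ℤ
      weights = solve-∀

    -- `D₀` descends to a map from G⁰ to coker b by `ΛF1⊆Ran`, and twice the center grows from n - 2
    -- to n. Its defect is the projection onto coker b, which commutes with Λ₀. So `D₀` vanishes
    -- modulo `Ran`, and the projection is zero.
    b-surjective : ∀ i v → Σ[ y ∈ C (i ℤ.+ 1ℤ) ] (F2 (i ℤ.+ 1ℤ) y × F1 i (v -[ i ] Λ i y))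
    b-surjective = at-suc _ λ i x → Ran.resp (i ℤ.+ 1ℤ) (_ , tt) (x , tt) ([D₀,L] i x)
      (Ran.minus-0⁻¹ _ {_ , tt} (defect-zero (shifted GM0) D₀-map D₀-vanishes i (x , tt)))
      where
      open Hom QM
      D₀-map : Hom (Sl2Module.family (shifted GM0))
      D₀-map i = record
        { apply = λ (x , _) → (D₀ i x , tt) , tt
        ; cong  = λ (x , _) (x′ , _) p → Ran.resp i
            (Λ i (x -[ i ℤ.+ 1ℤ ] x′) , tt) (D₀ i x -[ i ] D₀ i x′ , tt)
            (F1.mem i (Λ₀-cong i p) (At.≈ᴹ-trans i
              (At.-ᴹ-cong i (Λ-map.hom-minus i x x′) (At.≈ᴹ-refl i))
              (At.solve i (_ ∷ _ ∷ _ ∷ _ ∷ [])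
                (v₀ ⊖ v₁ ⊖ (v₀ ⊖ v₂ ⊖ (v₁ ⊖ v₃))) (v₂ ⊖ v₃) ≡.refl)))
            (ΛF1⊆Ran i _ p)
        ; hom-+ = λ (x , _) (x′ , _) → F1⊆Ran i (F1.mem i
            (F1.clo-neg i (Λ₀-map.hom-+ i (x , tt) (x′ , tt)))
            (At.≈ᴹ-trans i
              (At.-ᴹ-cong i (At.-ᴹ-cong i (Λ-map.hom-+ i x x′) (At.≈ᴹ-refl i)) (At.≈ᴹ-refl i))
              (At.solve i (_ ∷ _ ∷ _ ∷ _ ∷ _ ∷ [])
                (v₀ ⊕ v₁ ⊖ v₂ ⊖ (v₀ ⊖ v₃ ⊕ (v₁ ⊖ v₄))) (⊝ (v₂ ⊖ (v₃ ⊕ v₄))) ≡.refl)))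
        ; hom-· = λ c (x , _) → F1⊆Ran i (F1.mem i
            (F1.clo-neg i (Λ₀-map.hom-· i c (x , tt)))
            (At.≈ᴹ-trans i
              (At.-ᴹ-cong i (At.-ᴹ-cong i (Λ-map.hom-· i c x) (At.≈ᴹ-refl i)) (At.*ₗ-hom-minus i c _ _))
              (At.solve i (_ ∷ _ ∷ _ ∷ [])
                (v₀ ⊖ v₁ ⊖ (v₀ ⊖ v₂)) (⊝ (v₁ ⊖ v₂)) ≡.refl)))
        }
      weights : ∀ n → n ℤ.+ + 0 ≡ n ℤ.+ + 0 ℤ.- + 2 ℤ.+ + 2
      weights = solve-∀
      D₀-vanishes : IsZero D₀-map
      D₀-vanishes = vanishes QM-below r {d = 1} (shifted GM0) D₀-map (weights n)
        (defect-commutes⇒eigen (shifted GM0) D₀-map 2 λ j (x , _) → F1⊆Ran _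
          (F1.chain _ (Λ₀-cong _ ([D₀,L] _ x)) (F1.swap _ ([D₀,L] j (Λ₀ _ x)))))
        (shifted-above (Sl2Module.family GM0) (SQ0.subquotient-above V-above))

    -- The inverse β of b.

    β : Op⁺
    β i v = proj₁ (b-surjective i v)

    β-F2 : ∀ i v → F2 (i ℤ.+ 1ℤ) (β i v)
    β-F2 i v = proj₁ (proj₂ (b-surjective i v))

    Λβ : ∀ i v → F1 i (v -[ i ] Λ i (β i v))
    Λβ i v = proj₂ (proj₂ (b-surjective i v))

    -- Injectivity of b makes the chosen preimage canonical. Linearity of β and its compatibility
    -- with L and Λ then follow by exhibiting a preimage.
    β-unique : ∀ i {v y} → F2 (i ℤ.+ 1ℤ) y → F1 i (v -[ i ] Λ i y) → β i v ≈[ i ℤ.+ 1ℤ ] y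
    β-unique i {v} {y} p q = At.difference≈0⇒≈ _ _ _ (b-injective i _
      (F2.clo-minus _ (β-F2 i v) p)
      (F1.mem i (F1.clo-minus i q (Λβ i v)) (≈ᴹ-trans (Λ-map.hom-minus i _ _)
        (solve (_ ∷ _ ∷ _ ∷ []) (v₁ ⊖ v₂) (v₀ ⊖ v₂ ⊖ (v₀ ⊖ v₁)) ≡.refl))))
      where open At i

    β-cong : ∀ i {x y} → F1 i (x -[ i ] y) → β i x ≈[ i ℤ.+ 1ℤ ] β i y
    β-cong i p = β-unique i (β-F2 i _) (F1.chain i p (Λβ i _))

    β-Λ : ∀ i y → F2 (i ℤ.+ 1ℤ) y → β i (Λ i y) ≈[ i ℤ.+ 1ℤ ] y
    β-Λ i y p = β-unique i p (F1.≈⇒mem i (At.≈ᴹ-refl i))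

    β-map : ∀ i → LinearMap (V i) (V (i ℤ.+ 1ℤ))
    β-map i = record
      { apply = β i
      ; cong  = λ _ _ x≈y → β-cong i (F1.≈⇒mem i x≈y)
      ; hom-+ = λ x y → β-unique i (F2.clo-+ _ _ _ (β-F2 i x) (β-F2 i y))
          (F1.mem i (F1.clo-+ i _ _ (Λβ i x) (Λβ i y))
            (≈ᴹ-trans (-ᴹ-cong ≈ᴹ-refl (Λ-map.hom-+ i _ _))
              (solve (_ ∷ _ ∷ _ ∷ _ ∷ []) (v₀ ⊕ v₁ ⊖ (v₂ ⊕ v₃)) (v₀ ⊖ v₂ ⊕ (v₁ ⊖ v₃)) ≡.refl)))
      ; hom-· = λ c x → β-unique i (F2.clo-· _ c _ (β-F2 i x))
          (F1.mem i (F1.clo-· i c _ (Λβ i x))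
            (≈ᴹ-trans (-ᴹ-cong ≈ᴹ-refl (Λ-map.hom-· i c _)) (≈ᴹ-sym (*ₗ-hom-minus c _ _))))
      }
      where open At i

    β-L : ∀ i x → β (i ℤ.+ 1ℤ) (L i x) ≈[ i ℤ.+ 1ℤ ℤ.+ 1ℤ ] L (i ℤ.+ 1ℤ) (β i x)
    β-L i x = β-unique (i ℤ.+ 1ℤ) (F2.clo-L _ _ (β-F2 i x))
      (F1.chain _ (SQ0.L-linear-mod i (Λβ i x))
        (F1.swap _ ([Λ,L]-mem F1-sub i _ (F2⊆F1 _ _ (β-F2 i x)))))

    β-Λ₀ : ∀ i x → β i (Λ₀ i x) ≈[ i ℤ.+ 1ℤ ] Λ₂ (i ℤ.+ 1ℤ) (β (i ℤ.+ 1ℤ) x) (β-F2 _ x)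
    β-Λ₀ i x = β-unique i (Λ₂-F2 _ _ _)
      (F1.chain i (Λ₀-cong i (Λβ _ x)) (b-Λ-linear i _ (β-F2 _ x)))

    -- The projector onto F² and the components of the splitting.

    βΛ-map : ∀ i → LinearMap (V (i ℤ.+ 1ℤ)) (V (i ℤ.+ 1ℤ))
    βΛ-map i = record
      { apply = λ x → β i (Λ i x)
      ; cong  = λ x y x≈y → β-map.cong i _ _ (Λ-map.cong i x y x≈y)
      ; hom-+ = λ x y → At.≈ᴹ-trans _ (β-map.cong i _ _ (Λ-map.hom-+ i x y)) (β-map.hom-+ i _ _)
      ; hom-· = λ c x → At.≈ᴹ-trans _ (β-map.cong i _ _ (Λ-map.hom-· i c x)) (β-map.hom-· i _ _)
      }
      where module β-map i = LinearMap (β-map i)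

    -- The projector βΛ of V onto F² in all degrees. It is transported as a linear map, so that
    -- linearity comes along.
    γ-map : ∀ i → LinearMap (V i) (V i)
    γ-map = at-suc _ βΛ-map

    module γ i = LinearMap (γ-map i)

    γ : ∀ i → C i → C i
    γ = γ.apply

    γ-suc : ∀ i x → γ (i ℤ.+ 1ℤ) x ≡ β i (Λ i x)
    γ-suc i x = ≡.cong (λ f → LinearMap.apply f x) (at-suc-β (λ i → LinearMap (V i) (V i)) βΛ-map i)

    γ-F2 : ∀ i x → F2 i (γ i x)
    γ-F2 = at-suc _ λ i x → ≡.subst (F2 _) (≡.sym (γ-suc i x)) (β-F2 i (Λ i x))

    γ-on-F2 : ∀ i x → F2 i x → γ i x ≈[ i ] x
    γ-on-F2 = at-suc _ λ i x p →
      At.≈ᴹ-trans _ (At.≈ᴹ-reflexive _ (γ-suc i x)) (β-Λ i x p)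

    -- On F¹ the commutator of Λ and L stays in F¹, which β kills.
    γ-L : ∀ i x → F1 i x → γ (i ℤ.+ 1ℤ) (L i x) ≈[ i ℤ.+ 1ℤ ] L i (γ i x)
    γ-L = at-suc _ λ i x p → let open At (i ℤ.+ 1ℤ ℤ.+ 1ℤ) in begin
      γ (i ℤ.+ 1ℤ ℤ.+ 1ℤ) (L (i ℤ.+ 1ℤ) x)  ≡⟨ γ-suc (i ℤ.+ 1ℤ) _ ⟩
      β (i ℤ.+ 1ℤ) (Λ (i ℤ.+ 1ℤ) (L (i ℤ.+ 1ℤ) x))
        ≈⟨ β-cong (i ℤ.+ 1ℤ) ([Λ,L]-mem F1-sub i x p) ⟩
      β (i ℤ.+ 1ℤ) (L i (Λ i x))            ≈⟨ β-L i _ ⟩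
      L (i ℤ.+ 1ℤ) (β i (Λ i x))            ≡⟨ ≡.cong (L (i ℤ.+ 1ℤ)) (γ-suc i x) ⟨
      L (i ℤ.+ 1ℤ) (γ (i ℤ.+ 1ℤ) x)         ∎

    -- Λβ alone lifts G⁰ to V; subtracting Λ₂β, which has values in F², makes the lift commute with
    -- Λ. Removing the F²-part `γ` makes `α₁` vanish on F², so it descends to G¹.
    α₀ α₁ : ∀ i → C i → C i
    α₀ i x = D i (β i x) (β-F2 i x)
    α₁ i x = x -[ i ] γ i x

    α : Alpha H
    α g0 i x _ = α₀ i x
    α g1 i x _ = α₁ i x
    α g2 i x _ = x

    α₀-cong : ∀ i {x y} → F1 i (x -[ i ] y) → α₀ i x ≈[ i ] α₀ i y
    α₀-cong i p = D-cong i (β-cong i p)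

    α₀-+ : ∀ i x y → α₀ i (x +[ i ] y) ≈[ i ] (α₀ i x +[ i ] α₀ i y)
    α₀-+ i x y = At.≈ᴹ-trans i (D-cong i (LinearMap.hom-+ (β-map i) x y))
      (D-hom-+ i _ _ (β-F2 i x) (β-F2 i y))

    α₀-lift : ∀ i x → F1 i (α₀ i x -[ i ] x)
    α₀-lift i x = F1.mem i
      (F1.clo-neg i (F1.clo-+ i _ _ (Λβ i x) (F2⊆F1 i _ (Λ₂-F2 i _ (β-F2 i x)))))
      (At.solve i (_ ∷ _ ∷ _ ∷ []) (v₀ ⊖ v₁ ⊖ v₂) (⊝ (v₂ ⊖ v₀ ⊕ v₁)) ≡.refl)

    -- The defect of `D` is minus the inclusion of F², and composing with β gives the off-diagonal
    -- entry of L.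
    α₀-L : ∀ i x → (α₀ (i ℤ.+ 1ℤ) (L i x) -[ i ℤ.+ 1ℤ ] L i (α₀ i x))
                     ≈[ i ℤ.+ 1ℤ ] LeftModule.-ᴹ_ (V (i ℤ.+ 1ℤ)) (β i x)
    α₀-L i x = At.≈ᴹ-trans _
      (At.-ᴹ-cong _ (D-cong _ {p′ = F2.clo-L _ _ (β-F2 i x)} (β-L i x)) (At.≈ᴹ-refl _))
      ([D,L] i (β i x) (β-F2 i x))

    -- Here `D` is a map into V, and twice the center grows by w = 1. Its defect, minus the
    -- inclusion of F² in V, does not commute with Λ: the bracket is -(Λ - Λ₂) = -D. The eigenvalue
    -- is thus 1 - 1 = 0, which suffices for [Λ, D] = 0.
    Λ-D : ∀ i y p → Λ i (D (i ℤ.+ 1ℤ) y p) ≈[ i ] D i (Λ₂ (i ℤ.+ 1ℤ) y p) (Λ₂-F2 _ y p)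
    Λ-D i y p = At.difference≈0⇒≈ i _ _
      (adΛ-vanishes V-below r {d = 0} (shifted GM2) D-map (weights n) D-eigen
        (shifted-above (Sl2Module.family GM2) (SQ2.subquotient-above V-above)) i (y , p))
      where
      open Hom VM
      D-map : Hom (Sl2Module.family (shifted GM2))
      D-map i = record
        { apply = λ (y , p) → D i y p
        ; cong  = λ _ _ y≈y′ → D-cong i (At.difference≈0⇒≈ _ _ _ y≈y′)
        ; hom-+ = λ (y , p) (y′ , p′) → D-hom-+ i y y′ p p′
        ; hom-· = λ c (y , p) → D-hom-· i c y p
        }
      weights : ∀ n → n ℤ.+ 1ℤ ≡ n ℤ.+ + 2 ℤ.- + 2 ℤ.+ + 1
      weights = solve-∀
      D-eigen : Eigen (shifted GM2) D-map 1 0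
      D-eigen i (y , p) = begin
        Λ (i ℤ.+ 1ℤ) (defect (shifted GM2) D-map (i ℤ.+ 1ℤ) (y , p))
          -ᴹ defect (shifted GM2) D-map i (Λ₂ (i ℤ.+ 1ℤ) y p , _) +ᴹ (1# + 0#) *ₗ D (i ℤ.+ 1ℤ) y p
          ≈⟨ +ᴹ-cong
               (-ᴹ-cong (≈ᴹ-trans (Λ-map.cong _ _ _ ([D,L] _ y p)) (Λ-map.hom-neg _ y))
                        ([D,L] i _ (Λ₂-F2 _ y p)))
               (≈ᴹ-trans (*ₗ-congʳ (+-identityʳ 1#)) (*ₗ-identityˡ _)) ⟩
        -ᴹ Λ (i ℤ.+ 1ℤ) y -ᴹ -ᴹ Λ₂ (i ℤ.+ 1ℤ) y p +ᴹ (Λ (i ℤ.+ 1ℤ) y -ᴹ Λ₂ (i ℤ.+ 1ℤ) y p)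
          ≈⟨ solve (_ ∷ _ ∷ []) (⊝ v₀ ⊖ ⊝ v₁ ⊕ (v₀ ⊖ v₁)) 𝟘 ≡.refl ⟩
        0ᴹ
          ≈⟨ *ₗ-zeroˡ _ ⟨
        0# *ₗ D (i ℤ.+ 1ℤ) y p ∎
        where open At (i ℤ.+ 1ℤ)

    Λ-α₀ : ∀ i x → Λ i (α₀ (i ℤ.+ 1ℤ) x) ≈[ i ] α₀ i (Λ₀ i x)
    Λ-α₀ i x = At.≈ᴹ-trans i (Λ-D i _ (β-F2 _ x)) (D-cong i (At.≈ᴹ-sym _ (β-Λ₀ i x)))

    -- Gives Λy = α⁰(β⁻¹y) + Λ₂y on F², with Λy representing β⁻¹y: the last column of the matrix of
    -- Λ.
    α₀-Λ-F2 : ∀ i y p → α₀ i (Λ i y) ≈[ i ] D i y p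
    α₀-Λ-F2 i y p = D-cong i (β-Λ i y p)

    α₁-cong : ∀ i {x y} → F2 i (x -[ i ] y) → α₁ i x ≈[ i ] α₁ i y
    α₁-cong i {x} {y} p = difference≈0⇒≈ _ _ (begin
      x -ᴹ γ i x -ᴹ (y -ᴹ γ i y)
        ≈⟨ solve (x ∷ y ∷ γ i x ∷ γ i y ∷ []) (v₀ ⊖ v₂ ⊖ (v₁ ⊖ v₃)) (v₀ ⊖ v₁ ⊖ (v₂ ⊖ v₃)) ≡.refl ⟩
      x -ᴹ y -ᴹ (γ i x -ᴹ γ i y)
        ≈⟨ -ᴹ-cong ≈ᴹ-refl (≈ᴹ-trans (≈ᴹ-sym (γ.hom-minus i x y)) (γ-on-F2 i _ p)) ⟩
      x -ᴹ y -ᴹ (x -ᴹ y)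
        ≈⟨ -ᴹ‿inverseʳ _ ⟩
      0ᴹ ∎)
      where open At i

    α₁-+ : ∀ i x y → α₁ i (x +[ i ] y) ≈[ i ] (α₁ i x +[ i ] α₁ i y)
    α₁-+ i x y = ≈ᴹ-trans (-ᴹ-cong ≈ᴹ-refl (γ.hom-+ i x y))
      (solve (_ ∷ _ ∷ _ ∷ _ ∷ []) (v₀ ⊕ v₁ ⊖ (v₂ ⊕ v₃)) (v₀ ⊖ v₂ ⊕ (v₁ ⊖ v₃)) ≡.refl)
      where open At i

    α₁-· : ∀ i c x → α₁ i (c ·[ i ] x) ≈[ i ] (c ·[ i ] α₁ i x)
    α₁-· i c x = ≈ᴹ-trans (-ᴹ-cong ≈ᴹ-refl (γ.hom-· i c x)) (≈ᴹ-sym (*ₗ-hom-minus c _ _))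
      where open At i

    α₁-L : ∀ i x → F1 i x → α₁ (i ℤ.+ 1ℤ) (L i x) ≈[ i ℤ.+ 1ℤ ] L i (α₁ i x)
    α₁-L i x p = ≈ᴹ-trans (-ᴹ-cong ≈ᴹ-refl (γ-L i x p)) (≈ᴹ-sym (L-map.hom-minus i _ _))
      where open At (i ℤ.+ 1ℤ)

    -- α¹ is L-linear, and G¹ and V have the same center, so w = 0.
    Λ-α₁ : ∀ i x p → Λ i (α₁ (i ℤ.+ 1ℤ) x) ≈[ i ] α₁ i (ΛG g1 i x p)
    Λ-α₁ i x p = At.difference≈0⇒≈ i _ _
      (adΛ-vanishes V-below r {d = 0} GM1 α₁-map (≡.sym (ℤₚ.+-identityʳ _))
        (defect-commutes⇒eigen GM1 α₁-map 0 (linear⇒defect-commutes GM1 α₁-map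
          λ j (z , q) → At.≈⇒difference≈0 _ (α₁-L j z q)))
        (SQ1.subquotient-above V-above) i (x , p))
      where
      open Hom VM
      α₁-map : Hom (Sl2Module.family GM1)
      α₁-map i = record
        { apply = λ (x , _) → α₁ i x
        ; cong  = λ _ _ → α₁-cong i
        ; hom-+ = λ _ _ → α₁-+ i _ _
        ; hom-· = λ c _ → α₁-· i c _
        }

    -- Verification of the splitting, the conditions and the matrices.

    splitting : IsSplitting H α
    splitting = record
      { wd    = λ where
          g0 i _ _ _ _ → α₀-cong i
          g1 i _ _ _ _ → α₁-cong i
          g2 i _ _ _ _ → At.difference≈0⇒≈ i _ _
      ; hom-+ = λ where
          g0 i x y _ _ → α₀-+ i x y
          g1 i x y _ _ → α₁-+ i x y
          g2 i x y _ _ → At.≈ᴹ-refl i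
      ; hom-· = λ where
          g0 i c x _ → At.≈ᴹ-trans i (D-cong i (LinearMap.hom-· (β-map i) c x))
                         (D-hom-· i c _ (β-F2 i x))
          g1 i c x _ → α₁-· i c x
          g2 i c x _ → At.≈ᴹ-refl i
      ; filt  = filtered
      ; lift  = lifts
      ; surj  = λ i y → let open At i in
          -- Subtracting α⁰y leaves an element of F¹; α¹ recovers it up to its `γ`-part, which is
          -- the F²-component.
          y , y -ᴹ α₀ i y , F1.swap i (α₀-lift i y) , γ i (y -ᴹ α₀ i y) , γ-F2 i _ ,
          solve (_ ∷ _ ∷ _ ∷ []) (v₀ ⊕ (v₁ ⊖ v₀ ⊖ v₂) ⊕ v₂) v₁ ≡.refl
      ; inj   = injective
      }
      where
      filtered : ∀ a i x p → In a i (α a i x p)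
      filtered g0 i x p = tt
      filtered g1 i x p = F1.clo-minus i p (F2⊆F1 i _ (γ-F2 i x))
      filtered g2 i x p = p

      lifts : ∀ a i x p → Next a i (α a i x p -[ i ] x)
      lifts g0 i x p = α₀-lift i x
      lifts g1 i x p = F2.mem i (F2.clo-neg i (γ-F2 i x))
        (At.solve i (_ ∷ _ ∷ []) (v₀ ⊖ v₁ ⊖ v₀) (⊝ v₁) ≡.refl)
      lifts g2 i x p = At.-ᴹ‿inverseʳ i x

      -- The components are peeled off in turn: modulo F¹ only the first remains, so the α⁰-terms
      -- agree; modulo F² the second follows, and then the third.
      injective : ∀ i x0 x1 p1 x2 p2 y0 y1 q1 y2 q2 →
        αsum H α i x0 x1 p1 x2 p2 ≈[ i ] αsum H α i y0 y1 q1 y2 q2 →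
        F1 i (x0 -[ i ] y0) × F2 i (x1 -[ i ] y1) × Zero i (x2 -[ i ] y2)
      injective i x0 x1 p1 x2 p2 y0 y1 q1 y2 q2 eq = d0 , d1 , d2
        where
        open At i
        difference : ((α₀ i x0 +ᴹ α₁ i x1) +ᴹ x2) -ᴹ ((α₀ i y0 +ᴹ α₁ i y1) +ᴹ y2) ≈ᴹ 0ᴹ
        difference = ≈⇒difference≈0 eq
        d0 : F1 i (x0 -ᴹ y0)
        d0 = F1.mem i
          (F1.clo-+ i _ _ (F1.mem-0 i difference)
            (F1.clo-minus i
              (F1.clo-minus i (α₀-lift i y0) (α₀-lift i x0))
              (F1.clo-minus i
                (F1.clo-+ i _ _ (filtered g1 i x1 p1) (F2⊆F1 i _ p2))
                (F1.clo-+ i _ _ (filtered g1 i y1 q1) (F2⊆F1 i _ q2)))))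
          (solve (x0 ∷ y0 ∷ α₀ i x0 ∷ α₀ i y0 ∷ α₁ i x1 ∷ x2 ∷ α₁ i y1 ∷ y2 ∷ [])
            (v₀ ⊖ v₁)
            (v₂ ⊕ v₄ ⊕ v₅ ⊖ (v₃ ⊕ v₆ ⊕ v₇) ⊕ (v₃ ⊖ v₁ ⊖ (v₂ ⊖ v₀) ⊖ (v₄ ⊕ v₅ ⊖ (v₆ ⊕ v₇)))) ≡.refl)
        e0 : α₀ i x0 -ᴹ α₀ i y0 ≈ᴹ 0ᴹ
        e0 = ≈⇒difference≈0 (α₀-cong i d0)
        d1 : F2 i (x1 -ᴹ y1)
        d1 = F2.mem i
          (F2.clo-+ i _ _ (F2.mem-0 i difference)
            (F2.clo-minus i
              (F2.clo-minus i (lifts g1 i y1 q1) (lifts g1 i x1 p1))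
              (F2.clo-+ i _ _ (F2.mem-0 i e0) (F2.clo-minus i p2 q2))))
          (solve (x1 ∷ y1 ∷ α₀ i x0 ∷ α₀ i y0 ∷ α₁ i x1 ∷ x2 ∷ α₁ i y1 ∷ y2 ∷ [])
            (v₀ ⊖ v₁)
            (v₂ ⊕ v₄ ⊕ v₅ ⊖ (v₃ ⊕ v₆ ⊕ v₇) ⊕ (v₆ ⊖ v₁ ⊖ (v₄ ⊖ v₀) ⊖ (v₂ ⊖ v₃ ⊕ (v₅ ⊖ v₇)))) ≡.refl)
        e1 : α₁ i x1 -ᴹ α₁ i y1 ≈ᴹ 0ᴹ
        e1 = ≈⇒difference≈0 (α₁-cong i d1)
        d2 : x2 -ᴹ y2 ≈ᴹ 0ᴹ
        d2 = Z.mem i (Z.clo-minus i (Z.clo-minus i difference e0) e1)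
          (solve (α₀ i x0 ∷ α₀ i y0 ∷ α₁ i x1 ∷ x2 ∷ α₁ i y1 ∷ y2 ∷ [])
            (v₃ ⊖ v₅)
            (v₀ ⊕ v₂ ⊕ v₃ ⊖ (v₁ ⊕ v₄ ⊕ v₅) ⊖ (v₀ ⊖ v₁) ⊖ (v₂ ⊖ v₄)) ≡.refl)

    conditions : Conditions H α
    conditions = record
      { α1-L          = α₁-L
      ; α0-L-mod-Imα2 = λ i x → _ , F2.clo-neg _ (β-F2 i x) , α₀-L i x
      -- α⁰ commutes with Λ exactly, so the element of Im α¹ is α¹(0).
      ; α0-Λ-mod-Imα1 = λ i x → 0[ i ] , F1.has-0 i , let open At i in
          ≈ᴹ-trans (≈⇒difference≈0 (≈ᴹ-sym (Λ-α₀ i x)))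
            (≈ᴹ-sym (≈ᴹ-trans (-ᴹ-cong ≈ᴹ-refl (γ.hom-0 i)) (-ᴹ‿inverseʳ _)))
      }

    β-iso : IsLIso H β
    β-iso = record
      { into   = β-F2
      ; wd     = λ i _ _ → β-cong i
      ; hom-+  = λ i → LinearMap.hom-+ (β-map i)
      ; hom-·  = λ i → LinearMap.hom-· (β-map i)
      ; comm-L = β-L
      -- The inverse of β is b, whose representative is Λ on F².
      ; inv    = λ i y _ → Λ i y
      ; inv-wd = λ i y y′ _ _ y≈y′ → F1.≈⇒mem i (Λ-map.cong i y y′ y≈y′)
      ; β∘inv  = β-Λ
      ; inv∘β  = λ i x → F1.swap i (Λβ i x)
      }

    translates : Translates H α β β-iso
    translates = record
      { L-matrix = λ i x0 x1 p1 x2 p2 → let open At (i ℤ.+ 1ℤ) in begin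
          L i ((α₀ i x0 +[ i ] α₁ i x1) +[ i ] x2)
            ≈⟨ ≈ᴹ-trans (L-map.hom-+ i _ _) (+ᴹ-congʳ (L-map.hom-+ i _ _)) ⟩
          L i (α₀ i x0) +ᴹ L i (α₁ i x1) +ᴹ L i x2
            -- Replacing Lα⁰ by α⁰L costs minus the defect of α⁰; this is β applied to `x0`, and it
            -- joins the third component.
            ≈⟨ solve (α₀ (i ℤ.+ 1ℤ) (L i x0) ∷ L i (α₀ i x0) ∷ L i (α₁ i x1) ∷ L i x2 ∷ [])
                 (v₁ ⊕ v₂ ⊕ v₃) (v₀ ⊕ v₂ ⊕ (⊝ (v₀ ⊖ v₁) ⊕ v₃)) ≡.refl ⟩
          α₀ (i ℤ.+ 1ℤ) (L i x0) +ᴹ L i (α₁ i x1)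
            +ᴹ (-ᴹ (α₀ (i ℤ.+ 1ℤ) (L i x0) -ᴹ L i (α₀ i x0)) +ᴹ L i x2)
            ≈⟨ +ᴹ-cong (+ᴹ-congˡ (≈ᴹ-sym (α₁-L i x1 p1)))
                 (+ᴹ-congʳ (≈ᴹ-trans (-ᴹ‿cong (α₀-L i x0)) (solve (_ ∷ []) (⊝ ⊝ v₀) v₀ ≡.refl))) ⟩
          α₀ (i ℤ.+ 1ℤ) (L i x0) +ᴹ α₁ (i ℤ.+ 1ℤ) (L i x1) +ᴹ (β i x0 +ᴹ L i x2) ∎
      ; Λ-matrix = λ i x0 x1 p1 x2 p2 → let open At i in begin
          Λ i ((α₀ (i ℤ.+ 1ℤ) x0 +[ i ℤ.+ 1ℤ ] α₁ (i ℤ.+ 1ℤ) x1) +[ i ℤ.+ 1ℤ ] x2)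
            ≈⟨ ≈ᴹ-trans (Λ-map.hom-+ i _ _) (+ᴹ-congʳ (Λ-map.hom-+ i _ _)) ⟩
          Λ i (α₀ (i ℤ.+ 1ℤ) x0) +ᴹ Λ i (α₁ (i ℤ.+ 1ℤ) x1) +ᴹ Λ i x2
            ≈⟨ +ᴹ-congʳ (+ᴹ-cong (Λ-α₀ i x0) (Λ-α₁ i x1 p1)) ⟩
          α₀ i (Λ₀ i x0) +ᴹ α₁ i (ΛG g1 i x1 p1) +ᴹ Λ i x2
            ≈⟨ solve (_ ∷ _ ∷ _ ∷ Λ₂ i x2 p2 ∷ []) (v₀ ⊕ v₁ ⊕ v₂) (v₀ ⊕ (v₂ ⊖ v₃) ⊕ v₁ ⊕ v₃) ≡.refl ⟩
          α₀ i (Λ₀ i x0) +ᴹ D i x2 p2 +ᴹ α₁ i (ΛG g1 i x1 p1) +ᴹ Λ₂ i x2 p2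
            ≈⟨ +ᴹ-congʳ (+ᴹ-congʳ (+ᴹ-congˡ (α₀-Λ-F2 i x2 p2))) ⟨
          α₀ i (Λ₀ i x0) +ᴹ α₀ i (Λ i x2) +ᴹ α₁ i (ΛG g1 i x1 p1) +ᴹ Λ₂ i x2 p2
            ≈⟨ +ᴹ-congʳ (+ᴹ-congʳ (α₀-+ i _ _)) ⟨
          α₀ i (Λ₀ i x0 +ᴹ Λ i x2) +ᴹ α₁ i (ΛG g1 i x1 p1) +ᴹ Λ₂ i x2 p2 ∎
      }

    -- Uniqueness of the splitting.

    module Uniqueness (α α′ : Alpha H) (S : IsSplitting H α) (S′ : IsSplitting H α′)
                      (K : Conditions H α) (K′ : Conditions H α′) where
      private
        module S = IsSplitting S
        module S′ = IsSplitting S′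
        module K = Conditions K
        module K′ = Conditions K′

      δ : Alpha H
      δ a i x p = α a i x p -[ i ] α′ a i x p

      δ-cong : ∀ a i {x y p q} → Next a i (x -[ i ] y) → δ a i x p ≈[ i ] δ a i y q
      δ-cong a i x~y = At.-ᴹ-cong i (S.wd a i _ _ _ _ x~y) (S′.wd a i _ _ _ _ x~y)

      δ-hom-+ : ∀ a i x y p q → δ a i (x +[ i ] y) (In-+ a i x y p q) ≈[ i ] (δ a i x p +[ i ] δ a i y q)
      δ-hom-+ a i x y p q = ≈ᴹ-trans (-ᴹ-cong (S.hom-+ a i x y p q) (S′.hom-+ a i x y p q))
        (solve (_ ∷ _ ∷ _ ∷ _ ∷ []) (v₀ ⊕ v₁ ⊖ (v₂ ⊕ v₃)) (v₀ ⊖ v₂ ⊕ (v₁ ⊖ v₃)) ≡.refl)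
        where open At i

      δ-hom-· : ∀ a i c x p → δ a i (c ·[ i ] x) (In-· a i c x p) ≈[ i ] (c ·[ i ] δ a i x p)
      δ-hom-· a i c x p = ≈ᴹ-trans (-ᴹ-cong (S.hom-· a i c x p) (S′.hom-· a i c x p))
        (≈ᴹ-sym (*ₗ-hom-minus c _ _))
        where open At i

      -- Both maps lift the identity of G¹, so the difference has values in F². It is L-linear, and
      -- twice the center grows from n + 1 to n + 2.
      δ₁-zero : ∀ i x p → δ g1 i x p ≈[ i ] 0[ i ]
      δ₁-zero i x p = Z.minus-0⁻¹ i
        (vanishes (SQ2.subquotient-below V-below) r {d = 0} GM1 δ₁ (weights n)
          (defect-commutes⇒eigen GM1 δ₁ 1 (linear⇒defect-commutes GM1 δ₁ λ j (z , q) →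
            Z.minus-0 _ (At.≈ᴹ-trans _
              (LinearMap.difference-defect (Sl2Module.L-map VM j) _ _ _ _)
              (Z.clo-minus _ (Z.≈⇒mem _ (K.α1-L j z q)) (Z.≈⇒mem _ (K′.α1-L j z q))))))
          (SQ1.subquotient-above V-above) i (x , p))
        where
        open Hom GM2
        δ₁ : Hom (Sl2Module.family GM1)
        δ₁ i = record
          { apply = λ (x , p) → δ g1 i x p , F2.chain i (S.lift g1 i x p) (F2.swap i (S′.lift g1 i x p))
          ; cong  = λ _ _ x~y → Z.≈⇒mem i (δ-cong g1 i x~y)
          ; hom-+ = λ (x , p) (y , q) → Z.≈⇒mem i (δ-hom-+ g1 i x y p q)
          ; hom-· = λ c (x , p) → Z.≈⇒mem i (δ-hom-· g1 i c x p)
          }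
        weights : ∀ n → n ℤ.+ + 2 ≡ n ℤ.+ + 1 ℤ.+ + 1
        weights = solve-∀

      -- The images of the two splittings are not known to agree, but both lie in the same step of
      -- the filtration, where the conditions can be compared.
      Im⊆In : ∀ a i α → IsSplitting H α → ∀ {x} → Im H α a i x → In a i x
      Im⊆In g0 i α S _ = tt
      Im⊆In g1 i α S (z , p , x≈αz) = F1.mem i (IsSplitting.filt S g1 i z p) x≈αz
      Im⊆In g2 i α S (z , p , x≈αz) = F2.mem i (IsSplitting.filt S g2 i z p) x≈αz

      -- The difference has values in F¹. Its class in G¹ is L-linear, as Im α² lies in F², and
      -- twice the center grows from n to n + 1.
      δ₀-F2 : ∀ i x → F2 i (δ g0 i x tt)
      δ₀-F2 i x = F2.minus-0⁻¹ i
        (vanishes (SQ1.subquotient-below V-below) r {d = 0} GM0 δ₀ (weights n)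
          (defect-commutes⇒eigen GM0 δ₀ 1 (linear⇒defect-commutes GM0 δ₀ λ j (z , _) →
            F2.minus-0 _ (F2.mem _
              (F2.clo-minus _ (Im⊆In g2 _ α S (K.α0-L-mod-Imα2 j z)) (Im⊆In g2 _ α′ S′ (K′.α0-L-mod-Imα2 j z)))
              (LinearMap.difference-defect (Sl2Module.L-map VM j) _ _ _ _))))
          (SQ0.subquotient-above V-above) i (x , tt))
        where
        open Hom GM1
        δ₀ : Hom (Sl2Module.family GM0)
        δ₀ i = record
          { apply = λ (x , p) → δ g0 i x p , F1.chain i (S.lift g0 i x p) (F1.swap i (S′.lift g0 i x p))
          ; cong  = λ _ _ x~y → F2.≈⇒mem i (δ-cong g0 i x~y)
          ; hom-+ = λ (x , p) (y , q) → F2.≈⇒mem i (δ-hom-+ g0 i x y p q)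
          ; hom-· = λ c (x , p) → F2.≈⇒mem i (δ-hom-· g0 i c x p)
          }
        weights : ∀ n → n ℤ.+ + 1 ≡ n ℤ.+ + 0 ℤ.+ + 1
        weights = solve-∀

      -- Modulo F¹ the Λ-condition equates Λδ⁰ with δ⁰Λ₀, which lies in F² and hence in F¹. So b
      -- kills δ⁰, and b is injective.
      δ₀-zero : ∀ i x → δ g0 i x tt ≈[ i ] 0[ i ]
      δ₀-zero = at-suc _ λ i x → b-injective i _ (δ₀-F2 _ x)
        (F1.drop i
          (F1.swap i (F1.mem i
            (F1.clo-minus i (Im⊆In g1 _ α S (K.α0-Λ-mod-Imα1 i x)) (Im⊆In g1 _ α′ S′ (K′.α0-Λ-mod-Imα1 i x)))
            (LinearMap.difference-defect (Sl2Module.Λ-map VM i) _ _ _ _)))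
          (F2⊆F1 i _ (δ₀-F2 i _)))

      unique : ∀ a i x p → α a i x p ≈[ i ] α′ a i x p
      unique g0 i x p = At.difference≈0⇒≈ i _ _ (δ₀-zero i x)
      unique g1 i x p = At.difference≈0⇒≈ i _ _ (δ₁-zero i x p)
      unique g2 i x p = At.difference≈0⇒≈ i _ _ (Z.chain i (S.lift g2 i x p) (Z.swap i (S′.lift g2 i x p)))

theorem1p2p1 : (E : Field) → CharZero E →
    (V : ℤ → LeftModule (Field.ring E) 0ℓ 0ℓ) → (n : ℤ) →
    (H : Setup.Hypotheses E V n) → Setup.Conclusion E V H
theorem1p2p1 E char0 V n H =
  α , (splitting , conditions) ,
  (λ α′ S′ K′ → Uniqueness.unique α α′ splitting S′ conditions K′) ,
  β , β-iso , translates
  where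
  open Sl2Theory E char0
  open Bijectivity V n H
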